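{- Let $e$ be a prime with $e\equiv 1\pmod 4$. Suppose $u$ is an integer such that (1) $u$ is odd and $u^2\equiv -1\pmod e$, and (2) $u\equiv 2^l c^2 r\pm 1 \pmod{2^{l+1}c^2 e}$ for some integers $c>0$, $l\ge 0$ and $r$ with $2\mid 2^l c$, $r$ odd, and $r$ a quadratic non-residue modulo $e$ (i.e. $e\nmid r$ and $r$ is not congruent to a square modulo $e$). Then there is no binary sequence $\mathbf a$ of period $n=\tfrac12(u^2+1)$ with $C_{\mathbf a}(t)=1$ for all $1\le t\le n-1$.
   Context: A binary sequence of period $n$ is $\mathbf a=(a_0,a_1,\ldots)$ with $a_j\in\{ -1,1\}$ and $a_{j+n}=a_j$ for all $j\ge0$; its autocorrelation values are $C_{\mathbf a}(t)=\sum_{i=0}^{n-1}a_ia_{i+t}$, $0\le t\le n-1$. -}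

module Defs where

open import Data.Nat as ℕ using (ℕ; zero; suc)
open import Data.Integer as ℤ using (ℤ; +_; -_; _+_; _*_)
open import Data.Integer.Divisibility as ℤD using ()
open import Data.Product using (∃; _×_)
open import Data.Sum using (_⊎_)
open import Relation.Binary.PropositionalEquality using (_≡_)

Σ< : ℕ → (ℕ → ℤ) → ℤ
Σ< zero    f = + 0
Σ< (suc n) f = Σ< n f + f n

IsBinarySeq : ℕ → (ℕ → ℤ) → Set
IsBinarySeq n a = (∀ j → (a j ≡ + 1) ⊎ (a j ≡ - + 1)) × (∀ j → a (j ℕ.+ n) ≡ a j)

Autocorr : ℕ → (ℕ → ℤ) → ℕ → ℤ
Autocorr n a t = Σ< n (λ i → a i * a (i ℕ.+ t))

CongMod : ℤ → ℤ → ℤ → Set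
CongMod m x y = m ℤD.∣ (x ℤ.- y)

QNR : ℕ → ℤ → Set
QNR e r = (¬' (+ e ℤD.∣ r)) × (¬' (∃ λ (x : ℤ) → CongMod (+ e) r (x * x)))
  where
  open import Data.Empty using (⊥)
  ¬' : Set → Set
  ¬' P = P → ⊥

module Submission where

-- Mann's test.  Put A = 1 + a and let B ∈ ℤ[x]/(xᵉ − 1) be the image of A (note e ∣ n).  The
-- autocorrelation hypothesis becomes B(x)B(x⁻¹) ≡ n − 1 modulo multiples of 1 + x + … + xᵉ⁻¹, and
-- 2(n − 1) = (u − ε)(u + ε) for ε = ±1.  If p is a prime factor of n − 1 and some power q of p is
-- ≡ −1 mod e, then B(x)^q ≡ B(x^q) = B(x⁻¹) mod p, from which all coefficients of B are congruent
-- mod p; subtracting their common residue and dividing by p replaces n − 1 by (n − 1)/p².  So such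
-- p occur to an even power in n − 1.  A prime with no power ≡ −1 mod e has odd order mod e or equals
-- e, so it is a square mod e.  Since u − ε = 2ˡc²(r + 2em), and u − ε, u + ε have no common odd prime
-- factor, r is then a square up to sign, and −1 ≡ u² mod e.

open import Defs
open import Data.Nat as ℕ using (ℕ; _≤_; _^_; _%_)
open import Data.Nat.Primality using (Prime)
open import Data.Nat.Divisibility as ℕD using ()
open import Data.Product using (∃; _×_)
open import Data.Sum using (_⊎_)
open import Relation.Nullary using (¬_)
open import Relation.Binary.PropositionalEquality using (_≡_)
import Algebra.Properties.CommutativeSemigroup as CommutativeSemigroupProperties
import Algebra.Properties.Semiring.Binomial as SemiringBinomial
import Algebra.Properties.Semiring.Exp as SemiringExp
import Algebra.Properties.Semiring.Mult as SemiringMult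
import Algebra.Properties.Semiring.Sum as SemiringSum
import Data.Integer.Properties as ℤ
import Data.Integer.Tactic.RingSolver as ℤRing
import Data.Nat.Properties as ℕ
import Relation.Binary.Reasoning.Setoid as SetoidReasoning
open import Algebra.Bundles using (CommutativeMonoid; Semiring)
open import Algebra.Construct.Pointwise using (commutativeMonoid)
open import Data.Bool using (if_then_else_)
open import Data.Empty using (⊥; ⊥-elim)
open import Data.Fin using (Fin; fromℕ; fromℕ<; inject₁; toℕ) renaming (zero to fzero; suc to fsuc)
open import Data.Fin.Properties using (pigeonhole; suc-injective; toℕ-fromℕ; toℕ-fromℕ<; toℕ-inject₁; toℕ-injective; toℕ<n)
open import Data.Integer.Divisibility.Signed as S using ()
open import Data.List using ([]; _∷_)
open import Data.List.Relation.Unary.All using ([]; _∷_)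
open import Data.Nat using (NonZero; _/_; _<_; _∸_; pred; s≤s; suc; z≤n; zero)
open import Data.Nat.Combinatorics using (_C_; nCk+nC[k+1]≡[n+1]C[k+1]; nCn≡1)
open import Data.Nat.DivMod using (%-distribˡ-*; %-distribˡ-+; %-remove-+ʳ; %-remove-+ˡ; m%n%n≡m%n; m%n<n; m*n%n≡0; m<n⇒m%n≡m; m≡m%n+[m/n]*n)
open import Data.Nat.Divisibility using (_∣?_; _∤_)
open import Data.Nat.Induction using (<-rec)
open import Data.Nat.ListAction using (product)
open import Data.Nat.Primality using (euclidsLemma; prime[2]; prime⇒irreducible; prime⇒nonTrivial; prime⇒nonZero; ¬prime[1])
open import Data.Nat.Primality.Factorisation using (factorise)
open import Data.Nat.Tactic.RingSolver using (solve-∀)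
open import Data.Product using (_,_; proj₁; proj₂; ∃₂)
open import Data.Sum using ([_,_]′; inj₁; inj₂)
open import Function using (Equivalence; _∘_; _⇔_; mk⇔)
open import Level using (_⊔_)
open import Relation.Binary.PropositionalEquality using (_≢_; cong; cong₂; module ≡-Reasoning; refl; subst; sym; trans)
open import Relation.Nullary using (Dec; does; no; yes)

module _ where
  open import Data.Nat using (_+_; _*_)
  open import Data.Nat.Divisibility using (_∣_)

  -- Binomial coefficients divisible by a prime.

  [k+1]*[n+1]C[k+1]≡[n+1]*nCk : ∀ n k → suc k * (suc n C suc k) ≡ suc n * (n C k)
  [k+1]*[n+1]C[k+1]≡[n+1]*nCk zero zero = refl
  [k+1]*[n+1]C[k+1]≡[n+1]*nCk zero (suc k) = ℕ.*-zeroʳ k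
  [k+1]*[n+1]C[k+1]≡[n+1]*nCk (suc n) zero = begin
    suc (suc n) C 1 + 0              ≡⟨ ℕ.+-identityʳ _ ⟩
    suc (suc n) C 1                  ≡⟨ nCk+nC[k+1]≡[n+1]C[k+1] (suc n) 0 ⟨
    1 + (suc n C 1)                  ≡⟨ cong suc (ℕ.+-identityʳ _) ⟨
    1 + 1 * (suc n C 1)              ≡⟨ cong suc ([k+1]*[n+1]C[k+1]≡[n+1]*nCk n 0) ⟩
    suc (suc n) * 1                  ∎
    where open ≡-Reasoning
  [k+1]*[n+1]C[k+1]≡[n+1]*nCk (suc n) (suc k) = begin
    suc (suc k) * (suc (suc n) C suc (suc k))
      ≡⟨ cong (suc (suc k) *_) (nCk+nC[k+1]≡[n+1]C[k+1] (suc n) (suc k)) ⟨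
    suc (suc k) * ((suc n C suc k) + (suc n C suc (suc k)))
      ≡⟨ split (suc k) (suc n C suc k) _ ⟩
    (suc n C suc k) + (suc k * (suc n C suc k) + suc (suc k) * (suc n C suc (suc k)))
      ≡⟨ cong₂ (λ x y → (suc n C suc k) + (x + y))
           ([k+1]*[n+1]C[k+1]≡[n+1]*nCk n k) ([k+1]*[n+1]C[k+1]≡[n+1]*nCk n (suc k)) ⟩
    (suc n C suc k) + (suc n * (n C k) + suc n * (n C suc k))
      ≡⟨ cong ((suc n C suc k) +_) (ℕ.*-distribˡ-+ (suc n) (n C k) _) ⟨
    (suc n C suc k) + suc n * ((n C k) + (n C suc k))
      ≡⟨ cong (λ x → (suc n C suc k) + suc n * x) (nCk+nC[k+1]≡[n+1]C[k+1] n k) ⟩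
    suc (suc n) * (suc n C suc k) ∎
    where
    open ≡-Reasoning
    split : ∀ k x y → suc k * (x + y) ≡ x + (k * x + suc k * y)
    split = solve-∀

  -- By the absorption identity, p divides k times the binomial coefficient; since 0 < k < p it
  -- cannot divide k, so Euclid's lemma leaves only the coefficient.
  prime∣pCk : ∀ {p} → Prime p → ∀ k → 0 < k → k < p → p ∣ p C k
  prime∣pCk {suc n} pr (suc k) _ k<p
    with euclidsLemma (suc k) (suc n C suc k) pr
           (subst (suc n ∣_) (sym ([k+1]*[n+1]C[k+1]≡[n+1]*nCk n k)) (ℕD.m∣m*n _))
  ... | inj₁ p∣k = ⊥-elim (ℕD.>⇒∤ k<p p∣k)
  ... | inj₂ p∣C = p∣C

  -- The Frobenius endomorphism

  -- Characteristic p is expressed by the vanishing of p-fold sums. The semiring is not assumed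
  -- commutative, because it will consist of operators; commutation is required only of the elements
  -- involved.
  module Frobenius {a ℓ} (R : Semiring a ℓ) {p} (pr : Prime p)
    (char : ∀ x → Semiring._≈_ R (SemiringMult._×_ R p x) (Semiring.0# R)) where

    open Semiring R renaming (_+_ to _⊕_; _*_ to _⊗_; refl to ≈-refl; sym to ≈-sym; trans to ≈-trans; zero to zero′)
    open SemiringMult R renaming (_×_ to _⋆_)
    open SemiringSum R
    open SemiringExp R renaming (_^_ to _↑_)
    open SetoidReasoning setoid

    p∣n⇒n×x≈0 : ∀ {n} x → p ∣ n → n ⋆ x ≈ 0#
    p∣n⇒n×x≈0 x (ℕD.divides q refl) = begin
      (q * p) ⋆ x  ≡⟨ cong (_⋆ x) (ℕ.*-comm q p) ⟩
      (p * q) ⋆ x  ≈⟨ ×-assocˡ x p q ⟨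
      p ⋆ (q ⋆ x)  ≈⟨ char _ ⟩
      0#           ∎

    frobenius-+ : ∀ {x y} → x ⊗ y ≈ y ⊗ x → (x ⊕ y) ↑ p ≈ x ↑ p ⊕ y ↑ p
    frobenius-+ {x} {y} xy≈yx = go p refl
      where
      -- The exponent is a fresh variable equal to `p`, so that it can be matched as a successor and
      -- the extreme binomial terms exposed.
      go : ∀ q → p ≡ q → (x ⊕ y) ↑ q ≈ x ↑ q ⊕ y ↑ q
      go zero p≡0 = ⊥-elim (ℕ.≢-nonZero⁻¹ p {{prime⇒nonZero pr}} p≡0)
      go (suc q) p≡ = begin
        (x ⊕ y) ↑ suc q                              ≈⟨ SemiringBinomial.theorem R x y xy≈yx (suc q) ⟩
        t fzero ⊕ sum (t ∘ fsuc)                     ≈⟨ +-congˡ (sum-init-last (t ∘ fsuc)) ⟩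
        t fzero ⊕ (sum mid ⊕ t (fsuc (fromℕ q)))     ≈⟨ +-cong first (+-cong (≈-trans (sum-cong-≋ mid≈0) (sum-replicate-zero q)) last′) ⟩
        y ↑ suc q ⊕ (0# ⊕ x ↑ suc q)                 ≈⟨ +-congˡ (+-identityˡ _) ⟩
        y ↑ suc q ⊕ x ↑ suc q                        ≈⟨ +-comm _ _ ⟩
        x ↑ suc q ⊕ y ↑ suc q                        ∎
        where
        t = SemiringBinomial.binomialTerm R x y (suc q)
        mid : Fin q → Carrier
        mid i = t (fsuc (inject₁ i))
        first : t fzero ≈ y ↑ suc q
        first = ≈-trans (+-identityʳ _) (*-identityˡ _)
        mid≈0 : ∀ i → mid i ≈ 0#
        mid≈0 i = p∣n⇒n×x≈0 _ (subst (λ z → z ∣ suc q C k) (sym p≡)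
          (prime∣pCk (subst Prime p≡ pr) k (s≤s z≤n)
            (s≤s (subst (_< q) (sym (toℕ-inject₁ i)) (toℕ<n i)))))
          where k = suc (toℕ (inject₁ i))
        -- The index is generalised because `toℕ (fromℕ q)` equals `q` only propositionally.
        last : ∀ k → k ≡ q → (suc q C suc k) ⋆ (x ↑ suc k ⊗ y ↑ (q ∸ k)) ≈ x ↑ suc q
        last k refl = begin
          (suc q C suc q) ⋆ (x ↑ suc q ⊗ y ↑ (q ∸ q))  ≈⟨ ×-cong (nCn≡1 (suc q)) (*-congˡ (^-congʳ y (ℕ.n∸n≡0 q))) ⟩
          1 ⋆ (x ↑ suc q ⊗ 1#)                         ≈⟨ ≈-trans (+-identityʳ _) (*-identityʳ _) ⟩
          x ↑ suc q                                    ∎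
        last′ : t (fsuc (fromℕ q)) ≈ x ↑ suc q
        last′ = last _ (toℕ-fromℕ q)

    -- For x = 1 this is Fermat's little theorem, obtained by adding one copy of x at a time. It is
    -- why integer coefficients survive the Frobenius map unchanged.
    frobenius-× : ∀ n x → (n ⋆ x) ↑ p ≈ n ⋆ (x ↑ p)
    frobenius-× zero x = go p refl
      where
      go : ∀ q → p ≡ q → 0# ↑ q ≈ 0#
      go zero p≡0 = ⊥-elim (ℕ.≢-nonZero⁻¹ p {{prime⇒nonZero pr}} p≡0)
      go (suc q) _ = zeroˡ _
    frobenius-× (suc n) x = begin
      (x ⊕ n ⋆ x) ↑ p      ≈⟨ frobenius-+ (≈-trans (×-comm-* n x x) (≈-sym (×-assoc-* n x x))) ⟩
      x ↑ p ⊕ (n ⋆ x) ↑ p  ≈⟨ +-congˡ (frobenius-× n x) ⟩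
      x ↑ p ⊕ n ⋆ (x ↑ p)  ∎

    frobenius-sum : ∀ {n} (f : Fin n → Carrier) → (∀ i j → f i ⊗ f j ≈ f j ⊗ f i) →
                    sum f ↑ p ≈ sum (λ i → f i ↑ p)
    frobenius-sum {zero} f _ = frobenius-× 0 0#
    frobenius-sum {suc n} f comm = begin
      (f fzero ⊕ sum (f ∘ fsuc)) ↑ p                   ≈⟨ frobenius-+ f₀-comm ⟩
      f fzero ↑ p ⊕ sum (f ∘ fsuc) ↑ p                 ≈⟨ +-congˡ (frobenius-sum (f ∘ fsuc) (λ i j → comm _ _)) ⟩
      f fzero ↑ p ⊕ sum (λ i → f (fsuc i) ↑ p)         ∎
      where
      f₀-comm : f fzero ⊗ sum (f ∘ fsuc) ≈ sum (f ∘ fsuc) ⊗ f fzero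
      f₀-comm = begin
        f fzero ⊗ sum (f ∘ fsuc)             ≈⟨ *-distribˡ-sum (f fzero) (f ∘ fsuc) ⟩
        sum (λ i → f fzero ⊗ f (fsuc i))     ≈⟨ sum-cong-≋ (λ i → comm fzero (fsuc i)) ⟩
        sum (λ i → f (fsuc i) ⊗ f fzero)     ≈⟨ *-distribʳ-sum (f fzero) (f ∘ fsuc) ⟨
        sum (f ∘ fsuc) ⊗ f fzero             ∎

  -- The semiring of additive endomorphisms.

  module AdditiveEndomorphisms {a ℓ} (M : CommutativeMonoid a ℓ) where
    open CommutativeMonoid M renaming (_∙_ to _⊕_; ε to 0#; ∙-cong to ⊕-cong; identityˡ to ⊕-identityˡ;
      identityʳ to ⊕-identityʳ; assoc to ⊕-assoc; comm to ⊕-comm; refl to ≈-refl; sym to ≈-sym; trans to ≈-trans)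
    open CommutativeSemigroupProperties commutativeSemigroup using (interchange)

    record Endomorphism : Set (a ⊔ ℓ) where
      field
        fun    : Carrier → Carrier
        cong′  : ∀ {x y} → x ≈ y → fun x ≈ fun y
        homo   : ∀ x y → fun (x ⊕ y) ≈ fun x ⊕ fun y
        homo-0 : fun 0# ≈ 0#
    open Endomorphism public

    -- Polynomials will be represented by the operators they induce on sequences, so composition
    -- takes the place of polynomial multiplication. The product is noncommutative in general.
    endoSemiring : Semiring _ _
    endoSemiring = record
      { Carrier = Endomorphism
      ; _≈_ = λ F G → ∀ x → fun F x ≈ fun G x
      ; _+_ = λ F G → record
          { fun = λ x → fun F x ⊕ fun G x
          ; cong′ = λ x≈y → ⊕-cong (cong′ F x≈y) (cong′ G x≈y)
          ; homo = λ x y → ≈-trans (⊕-cong (homo F x y) (homo G x y)) (interchange _ _ _ _)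
          ; homo-0 = ≈-trans (⊕-cong (homo-0 F) (homo-0 G)) (⊕-identityˡ 0#) }
      ; _*_ = λ F G → record
          { fun = fun F ∘ fun G
          ; cong′ = cong′ F ∘ cong′ G
          ; homo = λ x y → ≈-trans (cong′ F (homo G x y)) (homo F _ _)
          ; homo-0 = ≈-trans (cong′ F (homo-0 G)) (homo-0 F) }
      ; 0# = record { fun = λ _ → 0# ; cong′ = λ _ → ≈-refl ; homo = λ _ _ → ≈-sym (⊕-identityˡ 0#) ; homo-0 = ≈-refl }
      ; 1# = record { fun = λ x → x ; cong′ = λ eq → eq ; homo = λ _ _ → ≈-refl ; homo-0 = ≈-refl }
      ; isSemiring = record
          { isSemiringWithoutAnnihilatingZero = record
              { +-isCommutativeMonoid = record
                  { isMonoid = record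
                      { isSemigroup = record
                          { isMagma = record
                              { isEquivalence = record
                                  { refl = λ _ → ≈-refl ; sym = λ eq x → ≈-sym (eq x) ; trans = λ eq eq′ x → ≈-trans (eq x) (eq′ x) }
                              ; ∙-cong = λ eq eq′ x → ⊕-cong (eq x) (eq′ x) }
                          ; assoc = λ F G H x → ⊕-assoc _ _ _ }
                      ; identity = (λ F x → ⊕-identityˡ _) , (λ F x → ⊕-identityʳ _) }
                  ; comm = λ F G x → ⊕-comm _ _ }
              ; *-cong = λ {F} {_} {_} {G′} eq eq′ x → ≈-trans (cong′ F (eq′ x)) (eq _)
              ; *-assoc = λ F G H x → ≈-refl
              ; *-identity = (λ F x → ≈-refl) , (λ F x → ≈-refl)
              ; distrib = (λ F G H x → homo F _ _) , (λ F G H x → ≈-refl) }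
          ; zero = (λ F x → ≈-refl) , (λ F x → homo-0 F) } }

  -- Finite sums and periodic sequences

  open SemiringSum ℕ.+-*-semiring using (sum; sum-cong-≗; ∑-comm; ∑-distrib-+; *-distribˡ-sum; *-distribʳ-sum; sum-init-last)

  ∑ : ℕ → (ℕ → ℕ) → ℕ
  ∑ n f = sum {n} (f ∘ toℕ)

  ∑-cong : ∀ n {f g : ℕ → ℕ} → (∀ i → f i ≡ g i) → ∑ n f ≡ ∑ n g
  ∑-cong n f≗g = sum-cong-≗ {n} (f≗g ∘ toℕ)

  ∑-cong-< : ∀ n {f g : ℕ → ℕ} → (∀ i → i < n → f i ≡ g i) → ∑ n f ≡ ∑ n g
  ∑-cong-< n f≗g = sum-cong-≗ {n} (λ i → f≗g (toℕ i) (toℕ<n i))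

  ∑-last : ∀ n f → ∑ (suc n) f ≡ ∑ n f + f n
  ∑-last n f = trans (sum-init-last {n} (f ∘ toℕ))
    (cong₂ _+_ (sum-cong-≗ {n} (λ i → cong f (toℕ-inject₁ i))) (cong f (toℕ-fromℕ n)))

  ∑-split : ∀ m n f → ∑ (m + n) f ≡ ∑ m f + ∑ n (λ i → f (m + i))
  ∑-split zero n f = refl
  ∑-split (suc m) n f = trans (cong (f 0 +_) (∑-split m n (f ∘ suc))) (sym (ℕ.+-assoc (f 0) _ _))

  ∑-blocks : ∀ m e f → ∑ (m * e) f ≡ ∑ m (λ s → ∑ e (λ i → f (i + s * e)))
  ∑-blocks zero e f = refl
  ∑-blocks (suc m) e f = begin
    ∑ (e + m * e) f
      ≡⟨ ∑-split e (m * e) f ⟩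
    ∑ e f + ∑ (m * e) (λ i → f (e + i))
      ≡⟨ cong₂ _+_ (∑-cong e (λ i → cong f (sym (ℕ.+-identityʳ i)))) (∑-blocks m e (λ i → f (e + i))) ⟩
    ∑ e (λ i → f (i + 0)) + ∑ m (λ s → ∑ e (λ i → f (e + (i + s * e))))
      ≡⟨ cong (∑ e (λ i → f (i + 0)) +_) (∑-cong m (λ s → ∑-cong e (λ i → cong f (x+[y+z]≡y+[x+z] e i (s * e))))) ⟩
    ∑ (suc m) (λ s → ∑ e (λ i → f (i + s * e))) ∎
    where
    open ≡-Reasoning
    x+[y+z]≡y+[x+z] : ∀ x y z → x + (y + z) ≡ y + (x + z)
    x+[y+z]≡y+[x+z] = solve-∀

  ∑-swap : ∀ m n (f : ℕ → ℕ → ℕ) → ∑ m (λ i → ∑ n (f i)) ≡ ∑ n (λ j → ∑ m (λ i → f i j))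
  ∑-swap m n f = ∑-comm {m} {n} (λ i j → f (toℕ i) (toℕ j))

  ∑-+ : ∀ n (f g : ℕ → ℕ) → ∑ n (λ i → f i + g i) ≡ ∑ n f + ∑ n g
  ∑-+ n f g = ∑-distrib-+ {n} (f ∘ toℕ) (g ∘ toℕ)

  ∑-*ˡ : ∀ n c (f : ℕ → ℕ) → ∑ n (λ i → c * f i) ≡ c * ∑ n f
  ∑-*ˡ n c f = sym (*-distribˡ-sum {n} c (f ∘ toℕ))

  ∑-*ʳ : ∀ n c (f : ℕ → ℕ) → ∑ n (λ i → f i * c) ≡ ∑ n f * c
  ∑-*ʳ n c f = sym (*-distribʳ-sum {n} c (f ∘ toℕ))

  Periodic : {A : Set} → ℕ → (ℕ → A) → Set
  Periodic n f = ∀ i → f (i + n) ≡ f i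

  periodic-+* : ∀ {A : Set} {n} {f : ℕ → A} → Periodic n f → ∀ i k → f (i + k * n) ≡ f i
  periodic-+* {f = f} per i zero = cong f (ℕ.+-identityʳ i)
  periodic-+* {n = n} {f} per i (suc k) = begin
    f (i + (n + k * n))   ≡⟨ cong f (trans (cong (i +_) (ℕ.+-comm n (k * n))) (sym (ℕ.+-assoc i _ n))) ⟩
    f (i + k * n + n)     ≡⟨ per _ ⟩
    f (i + k * n)         ≡⟨ periodic-+* per i k ⟩
    f i                   ∎
    where open ≡-Reasoning

  periodic-% : ∀ {A : Set} {n} .{{_ : NonZero n}} {f : ℕ → A} → Periodic n f → ∀ i → f (i % n) ≡ f i
  periodic-% {n = n} {f} per i =
    trans (sym (periodic-+* per (i % n) (i / n))) (cong f (sym (m≡m%n+[m/n]*n i n)))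

  -- A shift by one drops `g 0` and gains `g n`, which agree by periodicity. Splitting the sum of
  -- `suc n` terms at either end and cancelling `g 0` avoids subtraction.
  ∑-shift : ∀ {n f} → Periodic n f → ∀ t → ∑ n (λ i → f (i + t)) ≡ ∑ n f
  ∑-shift {n} {f} per zero = ∑-cong n (λ i → cong f (ℕ.+-identityʳ i))
  ∑-shift {n} {f} per (suc t) = begin
    ∑ n (λ i → f (i + suc t))   ≡⟨ ∑-cong n (λ i → cong f (ℕ.+-suc i t)) ⟩
    ∑ n (g ∘ suc)               ≡⟨ ℕ.+-cancelˡ-≡ (g 0) _ _ rotate ⟩
    ∑ n g                       ≡⟨ ∑-shift per t ⟩
    ∑ n f                       ∎
    where
    open ≡-Reasoning
    g : ℕ → ℕ
    g i = f (i + t)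
    rotate : g 0 + ∑ n (g ∘ suc) ≡ g 0 + ∑ n g
    rotate = begin
      ∑ (suc n) g   ≡⟨ ∑-last n g ⟩
      ∑ n g + g n   ≡⟨ cong (∑ n g +_) (trans (cong f (ℕ.+-comm n t)) (per t)) ⟩
      ∑ n g + g 0   ≡⟨ ℕ.+-comm (∑ n g) (g 0) ⟩
      g 0 + ∑ n g   ∎

  sum-select : ∀ {n} (f : Fin n → ℕ) j → (∀ k → k ≢ j → f k ≡ 0) → sum f ≡ f j
  sum-select {suc n} f fzero f≡0 = trans (cong (f fzero +_) (all0 n (f ∘ fsuc) (λ k → f≡0 (fsuc k) (λ ())))) (ℕ.+-identityʳ _)
    where
    all0 : ∀ n (g : Fin n → ℕ) → (∀ k → g k ≡ 0) → sum g ≡ 0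
    all0 zero g g≡0 = refl
    all0 (suc n) g g≡0 = cong₂ _+_ (g≡0 fzero) (all0 n (g ∘ fsuc) (g≡0 ∘ fsuc))
  sum-select {suc n} f (fsuc j) f≡0 = cong₂ _+_ (f≡0 fzero (λ ())) (sum-select (f ∘ fsuc) j (λ k k≢j → f≡0 (fsuc k) (k≢j ∘ suc-injective)))

  -- The indicator of the multiples of e. As a sequence it is the unit of the group ring of the
  -- integers mod e, so applying an operator to it reads off coefficients.
  δ : ℕ → ℕ → ℕ
  δ e i = if does (e ∣? i) then 1 else 0

  ∣⇒δ≡1 : ∀ {e i} → e ∣ i → δ e i ≡ 1
  ∣⇒δ≡1 {e} {i} e∣i with e ∣? i
  ... | yes _ = refl
  ... | no e∤i = ⊥-elim (e∤i e∣i)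

  ∤⇒δ≡0 : ∀ {e i} → e ∤ i → δ e i ≡ 0
  ∤⇒δ≡0 {e} {i} e∤i with e ∣? i
  ... | yes e∣i = ⊥-elim (e∤i e∣i)
  ... | no _ = refl

  -- The condition on `g` singles out the one index below e in the class of i. It is left abstract
  -- to cover both `q * k + i` and its multiple by `q`.
  ∑-δ : ∀ {e} .{{_ : NonZero e}} {b : ℕ → ℕ} → Periodic e b → ∀ (g : ℕ → ℕ) i →
        (∀ k → e ∣ g k ⇔ k % e ≡ i % e) → ∑ e (λ k → b k * δ e (g k)) ≡ b i
  ∑-δ {e} {b} per g i iff = begin
    ∑ e (λ k → b k * δ e (g k))      ≡⟨ sum-select _ j away ⟩
    b (toℕ j) * δ e (g (toℕ j))      ≡⟨ cong (b (toℕ j) *_) (∣⇒δ≡1 (Equivalence.from (iff (toℕ j)) (trans (cong (_% e) j≡i%e) (m%n%n≡m%n i e)))) ⟩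
    b (toℕ j) * 1                    ≡⟨ ℕ.*-identityʳ _ ⟩
    b (toℕ j)                        ≡⟨ cong b j≡i%e ⟩
    b (i % e)                        ≡⟨ periodic-% per i ⟩
    b i                              ∎
    where
    open ≡-Reasoning
    j : Fin e
    j = fromℕ< (m%n<n i e)
    j≡i%e : toℕ j ≡ i % e
    j≡i%e = toℕ-fromℕ< (m%n<n i e)
    away : ∀ k → k ≢ j → b (toℕ k) * δ e (g (toℕ k)) ≡ 0
    away k k≢j = trans (cong (b (toℕ k) *_) (∤⇒δ≡0 λ e∣gk → k≢j (toℕ-injective
        (trans (sym (m<n⇒m%n≡m (toℕ<n k))) (trans (Equivalence.to (iff (toℕ k)) e∣gk) (sym j≡i%e))))))
      (ℕ.*-zeroʳ (b (toℕ k)))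

  -- Residues modulo d, and operators on sequences modulo p.

  module Congruence (d : ℕ) .{{_ : NonZero d}} where
    infix 4 _≋_
    _≋_ : ℕ → ℕ → Set
    x ≋ y = x % d ≡ y % d

    +-mono-≋ : ∀ {x y u v} → x ≋ y → u ≋ v → x + u ≋ y + v
    +-mono-≋ {x} {y} {u} {v} p q = trans (%-distribˡ-+ x u d) (trans (cong₂ (λ a b → (a + b) % d) p q) (sym (%-distribˡ-+ y v d)))

    *-mono-≋ : ∀ {x y u v} → x ≋ y → u ≋ v → x * u ≋ y * v
    *-mono-≋ {x} {y} {u} {v} p q = trans (%-distribˡ-* x u d) (trans (cong₂ (λ a b → (a * b) % d) p q) (sym (%-distribˡ-* y v d)))

    +-0-commutativeMonoid-mod : CommutativeMonoid _ _
    +-0-commutativeMonoid-mod = record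
      { Carrier = ℕ ; _≈_ = _≋_ ; _∙_ = _+_ ; ε = 0
      ; isCommutativeMonoid = record
        { isMonoid = record
          { isSemigroup = record
            { isMagma = record
              { isEquivalence = record { refl = refl ; sym = sym ; trans = trans }
              ; ∙-cong = λ {x} {y} {u} {v} → +-mono-≋ {x} {y} {u} {v} }
            ; assoc = λ x y z → cong (_% d) (ℕ.+-assoc x y z) }
          ; identity = (λ _ → refl) , (λ x → cong (_% d) (ℕ.+-identityʳ x)) }
        ; comm = λ x y → cong (_% d) (ℕ.+-comm x y) } }

  module SequenceOperators (p : ℕ) (pr : Prime p) where
    private instance
      p≢0 : NonZero p
      p≢0 = prime⇒nonZero pr

    open Congruence p
    open AdditiveEndomorphisms (commutativeMonoid ℕ +-0-commutativeMonoid-mod) public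
    open Semiring endoSemiring public using (_≈_; Carrier)
      renaming (_+_ to _⊕_; _*_ to _⊗_; refl to ≈-refl; sym to ≈-sym; trans to ≈-trans)
    open Semiring endoSemiring using (setoid; *-identityʳ)
    open SemiringMult endoSemiring using (×-congʳ; ×-comm-*; ×-assoc-*) renaming (_×_ to _⋆_)
    open SemiringExp endoSemiring public using () renaming (_^_ to _↑_)
    open SemiringExp endoSemiring using (^-assocʳ; ^-congˡ; ^-congʳ)
    open SemiringSum endoSemiring using (sum-cong-≋) renaming (sum to ⨁)

    fun-⋆ : ∀ n F f i → fun (n ⋆ F) f i ≡ n * fun F f i
    fun-⋆ zero F f i = refl
    fun-⋆ (suc n) F f i = cong (fun F f i +_) (fun-⋆ n F f i)

    fun-⨁ : ∀ {n} (F : Fin n → Endomorphism) f i → fun (⨁ F) f i ≡ sum (λ k → fun (F k) f i)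
    fun-⨁ {zero} F f i = refl
    fun-⨁ {suc n} F f i = cong (fun (F fzero) f i +_) (fun-⨁ (F ∘ fsuc) f i)

    p⋆F≈0 : ∀ F → p ⋆ F ≈ Semiring.0# endoSemiring
    p⋆F≈0 F f i = trans (cong (_% p) (trans (fun-⋆ p F f i) (ℕ.*-comm p _))) (trans (m*n%n≡0 (fun F f i) p) (sym (m*n%n≡0 0 p)))

    open Frobenius endoSemiring pr p⋆F≈0

    shift : ℕ → Endomorphism
    shift k = record { fun = λ f i → f (k + i) ; cong′ = λ eq i → eq (k + i) ; homo = λ f g i → refl ; homo-0 = λ i → refl }

    shift-↑ : ∀ k n f i → fun (shift k ↑ n) f i ≡ f (n * k + i)
    shift-↑ k zero f i = refl
    shift-↑ k (suc n) f i = trans (shift-↑ k n f (k + i))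
      (cong f (trans (sym (ℕ.+-assoc (n * k) k i)) (cong (_+ i) (ℕ.+-comm (n * k) k))))

    shift-comm : ∀ j k → shift j ⊗ shift k ≈ shift k ⊗ shift j
    shift-comm j k f i = cong (λ x → f x % p) (x+[y+z]≡y+[x+z] k j i)
      where
      x+[y+z]≡y+[x+z] : ∀ x y z → x + (y + z) ≡ y + (x + z)
      x+[y+z]≡y+[x+z] = solve-∀

    module _ (e : ℕ) (b : ℕ → ℕ) where

      -- dilation q is B(x^q), where B(x) = Σ bₖ xᵏ and x acts on sequences as the shift.
      dilation : ℕ → Endomorphism
      dilation q = ⨁ {e} (λ k → b (toℕ k) ⋆ shift (q * toℕ k))

      dilation-apply : ∀ q f i → fun (dilation q) f i ≡ ∑ e (λ k → b k * f (q * k + i))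
      dilation-apply q f i = trans (fun-⨁ {e} _ f i) (sum-cong-≗ {e} (λ k → fun-⋆ (b (toℕ k)) (shift (q * toℕ k)) f i))

      -- Shifts commute with one another, so the Frobenius map may be taken term by term: it fixes
      -- each coefficient and multiplies each shift length by p.
      dilation-↑p : ∀ q → dilation q ↑ p ≈ dilation (p * q)
      dilation-↑p q = begin
        ⨁ term ↑ p              ≈⟨ frobenius-sum term term-comm ⟩
        ⨁ (λ k → term k ↑ p)    ≈⟨ sum-cong-≋ {e} {λ k → term k ↑ p} {term′} term-↑p ⟩
        ⨁ term′                 ∎
        where
        open SetoidReasoning setoid
        s : Fin e → Endomorphism
        s k = shift (q * toℕ k)
        term term′ : Fin e → Endomorphism
        term k = b (toℕ k) ⋆ s k
        term′ k = b (toℕ k) ⋆ shift (p * q * toℕ k)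
        term-comm : ∀ i j → term i ⊗ term j ≈ term j ⊗ term i
        term-comm i j = let m = b (toℕ i); n = b (toℕ j) in begin
          (m ⋆ s i) ⊗ (n ⋆ s j)    ≈⟨ ×-assoc-* m (s i) (n ⋆ s j) ⟩
          m ⋆ (s i ⊗ (n ⋆ s j))    ≈⟨ ×-congʳ m (×-comm-* n (s i) (s j)) ⟩
          m ⋆ (n ⋆ (s i ⊗ s j))    ≈⟨ ×-congʳ m (×-congʳ n (shift-comm (q * toℕ i) (q * toℕ j))) ⟩
          m ⋆ (n ⋆ (s j ⊗ s i))    ≈⟨ ×-congʳ m (×-assoc-* n (s j) (s i)) ⟨
          m ⋆ ((n ⋆ s j) ⊗ s i)    ≈⟨ ×-comm-* m (n ⋆ s j) (s i) ⟨
          (n ⋆ s j) ⊗ (m ⋆ s i)    ∎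
        term-↑p : ∀ k → term k ↑ p ≈ term′ k
        term-↑p k = begin
          (b (toℕ k) ⋆ s k) ↑ p    ≈⟨ frobenius-× (b (toℕ k)) (s k) ⟩
          b (toℕ k) ⋆ (s k ↑ p)    ≈⟨ ×-congʳ (b (toℕ k)) {s k ↑ p} {shift (p * q * toℕ k)} (λ f i → cong (_% p) (trans (shift-↑ (q * toℕ k) p f i)
                                        (cong (λ x → f (x + i)) (sym (ℕ.*-assoc p q (toℕ k)))))) ⟩
          term′ k                  ∎

      dilation-↑p^ : ∀ j → dilation 1 ↑ (p ^ j) ≈ dilation (p ^ j)
      dilation-↑p^ zero = *-identityʳ (dilation 1)
      dilation-↑p^ (suc j) = begin
        dilation 1 ↑ (p * p ^ j)      ≈⟨ ^-congʳ (dilation 1) (ℕ.*-comm p (p ^ j)) ⟩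
        dilation 1 ↑ (p ^ j * p)      ≈⟨ ^-assocʳ (dilation 1) (p ^ j) p ⟨
        (dilation 1 ↑ (p ^ j)) ↑ p    ≈⟨ ^-congˡ p (dilation-↑p^ j) ⟩
        dilation (p ^ j) ↑ p          ≈⟨ dilation-↑p (p ^ j) ⟩
        dilation (p * p ^ j)          ∎
        where open SetoidReasoning setoid

      Const : (ℕ → ℕ) → Set
      Const f = ∃ λ c → ∀ i → f i ≋ c

      -- Constant sequences correspond to the multiples of 1 + x + ... + xᵉ⁻¹, which form an ideal:
      -- B acts on them by multiplication with its coefficient sum.
      dilation-↑-const : ∀ m f → Const f → Const (fun (dilation 1 ↑ m) f)
      dilation-↑-const zero f cst = cst
      dilation-↑-const (suc m) f cst with c , f≋c ← dilation-↑-const m f cst =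
        ∑ e (λ k → b k * c) , λ i → trans (cong′ (dilation 1) f≋c i) (cong (_% p) (dilation-apply 1 (λ _ → c) i))

  -- Mann's descent at a prime with a power congruent to -1.

  -- Coefficientwise form of B(x)B(x⁻¹) = N + M(1 + x + … + xᵉ⁻¹) in ℤ[x]/(xᵉ − 1), with M eliminated.
  record TwoLevel (e N : ℕ) : Set where
    field
      seq      : ℕ → ℕ
      periodic : Periodic e seq
      levels   : ∀ t → e ∤ t → ∑ e (λ k → seq k * seq k) ≡ ∑ e (λ k → seq k * seq (k + t)) + N

  -- With q = p^(j+1) ≡ −1 mod e, B(x)^(q+1) ≡ B(x⁻¹)B(x) is mod p a multiple of
  -- 1 + x + … + xᵉ⁻¹, hence so is the higher power B(x)^(q²) ≡ B(x^(q²)) = B(x).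
  module Mann {e p : ℕ} .{{_ : NonZero e}} (pr : Prime p) (1<e : 1 < e) (j : ℕ) (e∣p^j+1 : e ∣ p ^ suc j + 1)
              {N : ℕ} (p∣N : p ∣ N) (B : TwoLevel e N) where
    open TwoLevel B renaming (seq to b)
    open SequenceOperators p pr
    private instance
      p≢0 : NonZero p
      p≢0 = prime⇒nonZero pr
    open Congruence p

    q = p ^ suc j

    e∣qx⇒e∣x : ∀ {x} → e ∣ q * x → e ∣ x
    e∣qx⇒e∣x {x} e∣qx = ℕD.∣m+n∣m⇒∣n (subst (e ∣_) (eq q x) (ℕD.∣m⇒∣m*n x e∣p^j+1)) e∣qx
      where
      eq : ∀ q x → (q + 1) * x ≡ q * x + x
      eq = solve-∀

    e∣qk+i⇔k≡i : ∀ i k → e ∣ q * k + i ⇔ k % e ≡ i % e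
    e∣qk+i⇔k≡i i k = mk⇔
      (λ e∣ → trans (sym (%-remove-+ʳ k e∣)) (trans (cong (_% e) (eq q k i)) (%-remove-+ˡ i (ℕD.∣m⇒∣m*n k e∣p^j+1))))
      (λ k≡i → ℕD.m%n≡0⇒n∣m _ e (trans (Congruence.+-mono-≋ e {q * k} {q * k} {i} {k} refl (sym k≡i))
        (ℕD.n∣m⇒m%n≡0 _ e (subst (e ∣_) (eq′ q k) (ℕD.∣m⇒∣m*n k e∣p^j+1)))))
      where
      eq : ∀ q k i → k + (q * k + i) ≡ (q + 1) * k + i
      eq = solve-∀
      eq′ : ∀ q k → (q + 1) * k ≡ q * k + k
      eq′ = solve-∀

    -- Since q ≡ -1 mod e, only the k congruent to i contributes: B(x^q) acts on the unit as B(x⁻¹).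
    dilation-q-δ : ∀ i → fun (dilation e b q) (δ e) i ≡ b i
    dilation-q-δ i = trans (dilation-apply e b q (δ e) i) (∑-δ periodic _ i (e∣qk+i⇔k≡i i))

    -- Evaluation at `q * m` lets a factor q be pulled out of `q * q * k + q * m`; q is invertible
    -- mod e, so the criterion for `q * k + m` applies again.
    dilation-q²-δ : ∀ m → fun (dilation e b (q * q)) (δ e) (q * m) ≡ b m
    dilation-q²-δ m = trans (dilation-apply e b (q * q) (δ e) (q * m)) (∑-δ periodic _ m λ k →
      mk⇔ (λ e∣ → Equivalence.to (e∣qk+i⇔k≡i m k) (e∣qx⇒e∣x (subst (e ∣_) (eq q k m) e∣)))
          (λ k≡m → subst (e ∣_) (sym (eq q k m)) (ℕD.∣n⇒∣m*n q (Equivalence.from (e∣qk+i⇔k≡i m k) k≡m))))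
      where
      eq : ∀ q k m → q * q * k + q * m ≡ q * (q * k + m)
      eq = solve-∀

    correlation : (ℕ → ℕ) → ℕ → ℕ
    correlation f t = ∑ e (λ k → f k * f (k + t))

    correlation≋ : ∀ t → correlation b t ≋ ∑ e (λ k → b k * b k)
    correlation≋ t with e ∣? t
    ... | yes (ℕD.divides s refl) = cong (_% p) (∑-cong e (λ k → cong (b k *_) (periodic-+* periodic k s)))
    ... | no e∤t = sym (trans (cong (_% p) (levels t e∤t)) (%-remove-+ʳ (correlation b t) p∣N))

    -- One factor B is split off. The other q factors turn the unit into `b` by Frobenius, and the
    -- remaining factor turns `b` into its correlations, which agree mod p because p divides N.
    const-suc-q : Const e b (fun (dilation e b 1 ↑ suc q) (δ e))
    const-suc-q = _ , λ i → begin
      fun (dilation e b 1 ↑ suc q) (δ e) i % p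
        ≡⟨ cong′ (dilation e b 1) (λ i → trans (dilation-↑p^ e b (suc j) (δ e) i) (cong (_% p) (dilation-q-δ i))) i ⟩
      fun (dilation e b 1) b i % p
        ≡⟨ cong (_% p) (trans (dilation-apply e b 1 b i) (∑-cong e (λ k → cong (λ x → b k * b (x + i)) (ℕ.*-identityˡ k)))) ⟩
      correlation b i % p
        ≡⟨ correlation≋ i ⟩
      ∑ e (λ k → b k * b k) % p ∎
      where open ≡-Reasoning

    suc-q≤q² : suc q ≤ q * q
    suc-q≤q² = ℕ.≤-trans (ℕ.+-mono-≤ 1≤q (ℕ.≤-refl {q})) (ℕ.≤-trans (ℕ.≤-reflexive (eq q)) (ℕ.*-monoˡ-≤ q 2≤q))
      where
      eq : ∀ q → q + q ≡ 2 * q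
      eq = solve-∀
      2≤p = ℕ.nonTrivial⇒n>1 p {{prime⇒nonTrivial pr}}
      2≤q : 2 ≤ q
      2≤q = ℕ.≤-trans 2≤p (ℕ.m≤m*n p (p ^ j) {{ℕ.m^n≢0 p j}})
      1≤q : 1 ≤ q
      1≤q = ℕ.≤-trans (s≤s z≤n) 2≤q

    const-mod-p : ∃ λ c → ∀ i → b i ≋ c
    const-mod-p = c , λ i → begin
      b i % p                                                       ≡⟨ cong (_% p) (dilation-q²-δ i) ⟨
      fun (dilation e b (q * q)) (δ e) (q * i) % p                  ≡⟨ cong (λ x → fun (dilation e b x) (δ e) (q * i) % p) (ℕ.^-distribˡ-+-* p (suc j) (suc j)) ⟨
      fun (dilation e b (p ^ (suc j + suc j))) (δ e) (q * i) % p    ≡⟨ dilation-↑p^ e b (suc j + suc j) (δ e) (q * i) ⟨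
      fun (dilation e b 1 ↑ (p ^ (suc j + suc j))) (δ e) (q * i) % p ≡⟨ cong (λ x → fun (dilation e b 1 ↑ x) (δ e) (q * i) % p) (trans (ℕ.^-distribˡ-+-* p (suc j) (suc j)) (sym (ℕ.m∸n+n≡m suc-q≤q²))) ⟩
      fun (dilation e b 1 ↑ (r + suc q)) (δ e) (q * i) % p          ≡⟨ SemiringExp.^-homo-* endoSemiring (dilation e b 1) r (suc q) (δ e) (q * i) ⟩
      fun (dilation e b 1 ↑ r) (fun (dilation e b 1 ↑ suc q) (δ e)) (q * i) % p ≡⟨ proj₂ const (q * i) ⟩
      c % p ∎
      where
      open ≡-Reasoning
      -- The exponent q² is split as r + (q + 1): the last q + 1 factors produce a constant, and the
      -- other r keep it constant.
      r = q * q ∸ suc q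
      const = dilation-↑-const e b r _ const-suc-q
      c = proj₁ const

    c = b 0 % p

    d : ℕ → ℕ
    d i = b i / p

    d-periodic : Periodic e d
    d-periodic i = cong (_/ p) (periodic i)

    b≡c+dp : ∀ i → b i ≡ c + d i * p
    b≡c+dp i = trans (m≡m%n+[m/n]*n (b i) p)
      (cong (_+ d i * p) (trans (proj₂ const-mod-p i) (sym (proj₂ const-mod-p 0))))

    -- The part of the correlation of b = c + p d that does not depend on the shift; both cross
    -- terms contribute the full sum of `d`, by shift invariance. It cancels when two correlations
    -- are compared.
    K = ∑ e (λ _ → c * c) + c * p * ∑ e d + c * p * ∑ e d

    correlation-b : ∀ t → correlation b t ≡ K + p * p * correlation d t
    correlation-b t = begin
      ∑ e (λ k → b k * b (k + t))
        ≡⟨ ∑-cong e (λ k → trans (cong₂ _*_ (b≡c+dp k) (b≡c+dp (k + t))) (expand c p (d k) (d (k + t)))) ⟩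
      ∑ e (λ k → c * c + c * p * d k + c * p * d (k + t) + p * p * (d k * d (k + t)))
        ≡⟨ ∑-+ e (λ k → c * c + c * p * d k + c * p * d (k + t)) (λ k → p * p * (d k * d (k + t))) ⟩
      ∑ e (λ k → c * c + c * p * d k + c * p * d (k + t)) + ∑ e (λ k → p * p * (d k * d (k + t)))
        ≡⟨ cong₂ _+_ (∑-+ e (λ k → c * c + c * p * d k) (λ k → c * p * d (k + t))) (∑-*ˡ e (p * p) (λ k → d k * d (k + t))) ⟩
      ∑ e (λ k → c * c + c * p * d k) + ∑ e (λ k → c * p * d (k + t)) + p * p * correlation d t
        ≡⟨ cong (_+ p * p * correlation d t) (cong₂ _+_
             (trans (∑-+ e (λ _ → c * c) (λ k → c * p * d k)) (cong (∑ e (λ _ → c * c) +_) (∑-*ˡ e (c * p) d)))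
             (trans (∑-*ˡ e (c * p) (λ k → d (k + t))) (cong (c * p *_) (∑-shift d-periodic t)))) ⟩
      K + p * p * correlation d t ∎
      where
      open ≡-Reasoning
      expand : ∀ c p x y → (c + x * p) * (c + y * p) ≡ c * c + c * p * x + c * p * y + p * p * (x * y)
      expand = solve-∀

    correlation-0 : ∀ f → correlation f 0 ≡ ∑ e (λ k → f k * f k)
    correlation-0 f = ∑-cong e (λ k → cong (λ x → f k * f x) (ℕ.+-identityʳ k))

    p²-levels : ∀ t → e ∤ t → p * p * correlation d 0 ≡ p * p * correlation d t + N
    p²-levels t e∤t = ℕ.+-cancelˡ-≡ K _ _ (begin
      K + p * p * correlation d 0        ≡⟨ correlation-b 0 ⟨
      correlation b 0                    ≡⟨ correlation-0 b ⟩
      ∑ e (λ k → b k * b k)              ≡⟨ levels t e∤t ⟩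
      correlation b t + N                ≡⟨ cong (_+ N) (correlation-b t) ⟩
      K + p * p * correlation d t + N    ≡⟨ ℕ.+-assoc K _ N ⟩
      K + (p * p * correlation d t + N)  ∎)
      where open ≡-Reasoning

    p²∣N : p * p ∣ N
    -- Since 1 < e, the shift 1 is not a multiple of e; N is then a difference of two multiples of
    -- p².
    p²∣N = ℕD.∣m+n∣m⇒∣n (subst (p * p ∣_) (p²-levels 1 (ℕD.>⇒∤ 1<e)) (ℕD.m∣m*n _)) (ℕD.m∣m*n (correlation d 1))

    descent : ∃ λ N′ → N ≡ p * p * N′ × TwoLevel e N′
    descent = N′ , N≡ , record
      { seq = d
      ; periodic = d-periodic
      ; levels = λ t e∤t → trans (sym (correlation-0 d)) (ℕ.*-cancelˡ-≡ _ _ (p * p) {{ℕ.m*n≢0 p p}}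
          (trans (p²-levels t e∤t) (trans (cong (p * p * correlation d t +_) N≡) (sym (ℕ.*-distribˡ-+ (p * p) _ N′)))))
      }
      where
      N′ = ℕD.quotient p²∣N
      N≡ = ℕD.m∣n⇒n≡m*quotient p²∣N

  module _ {e} .{{_ : NonZero e}} where
    open Congruence e

    m+n≋m⇒∣n : ∀ m n → m + n ≋ m → e ∣ n
    m+n≋m⇒∣n m n eq = ℕD.∣m+n∣m⇒∣n (ℕD.divides ((m + n) / e) (ℕ.+-cancelˡ-≡ (m % e) _ _ (begin
      m % e + (m / e * e + n)         ≡⟨ ℕ.+-assoc (m % e) _ n ⟨
      m % e + m / e * e + n           ≡⟨ cong (_+ n) (m≡m%n+[m/n]*n m e) ⟨
      m + n                           ≡⟨ m≡m%n+[m/n]*n (m + n) e ⟩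
      (m + n) % e + (m + n) / e * e   ≡⟨ cong (_+ (m + n) / e * e) eq ⟩
      m % e + (m + n) / e * e         ∎))) (ℕD.n∣m*n (m / e))
      where open ≡-Reasoning

  -- Squares modulo a prime

  -- Multiples of e count as squares, so the prime e itself needs no separate treatment as a factor.
  SquareMod : (e : ℕ) .{{_ : NonZero e}} → ℕ → Set
  SquareMod e a = ∃ λ x → x * x % e ≡ a % e

  squareMod-* : ∀ {e} .{{_ : NonZero e}} {a b} → SquareMod e a → SquareMod e b → SquareMod e (a * b)
  squareMod-* {e} {a} {b} (x , x²≡a) (y , y²≡b) = x * y , trans (cong (_% e) (swap x y)) (Congruence.*-mono-≋ e {x * x} {a} {y * y} {b} x²≡a y²≡b)
    where
    swap : ∀ x y → x * y * (x * y) ≡ x * x * (y * y)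
    swap = solve-∀

  half : ∀ n → ∃ λ g → n ≡ g + g ⊎ n ≡ suc (g + g)
  half zero = 0 , inj₁ refl
  half (suc n) with half n
  ... | g , inj₁ n≡ = g , inj₂ (cong suc n≡)
  ... | g , inj₂ n≡ = suc g , inj₁ (cong suc (trans n≡ (sym (ℕ.+-suc g g))))

  module _ {e} (e-prime : Prime e) where
    private instance
      e≢0 : NonZero e
      e≢0 = prime⇒nonZero e-prime
    open Congruence e

    ∣^*⇒∣ : ∀ {a} → e ∤ a → ∀ n {x} → e ∣ a ^ n * x → e ∣ x
    ∣^*⇒∣ e∤a zero {x} e∣ = subst (e ∣_) (ℕ.+-identityʳ x) e∣
    ∣^*⇒∣ {a} e∤a (suc n) {x} e∣ with euclidsLemma a (a ^ n * x) e-prime (subst (e ∣_) (ℕ.*-assoc a (a ^ n) x) e∣)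
    ... | inj₁ e∣a = ⊥-elim (e∤a e∣a)
    ... | inj₂ e∣′ = ∣^*⇒∣ e∤a n e∣′

    ∤⇒nonZero : ∀ {a} → e ∤ a → NonZero a
    ∤⇒nonZero {zero} e∤0 = ⊥-elim (e∤0 (e ℕD.∣0))
    ∤⇒nonZero {suc a} _ = _

    suc-pred-^ : ∀ {a} → e ∤ a → ∀ n → suc (pred (a ^ n)) ≡ a ^ n
    suc-pred-^ {a} e∤a n = ℕ.suc-pred _ {{ℕ.m^n≢0 a n {{∤⇒nonZero e∤a}}}}

    -- Among the e + 1 powers with exponents 0 to e, two agree mod e; their smaller power of a
    -- cancels. The witness x is the difference of the remaining power and 1.
    finiteOrder : ∀ {a} → e ∤ a → ∃₂ λ k x → a ^ suc k ≡ suc x × e ∣ x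
    finiteOrder {a} e∤a with i , j , i<j , fi≡fj ← pigeonhole (ℕ.n<1+n e) (λ i → fromℕ< (m%n<n (a ^ toℕ i) e)) =
      k , x , sym suc-x≡ , ∣^*⇒∣ e∤a (toℕ i) (m+n≋m⇒∣n (a ^ toℕ i) _ (begin
        (a ^ toℕ i + a ^ toℕ i * x) % e       ≡⟨ cong (_% e) (ℕ.*-suc (a ^ toℕ i) x) ⟨
        a ^ toℕ i * suc x % e                 ≡⟨ cong (λ y → a ^ toℕ i * y % e) suc-x≡ ⟩
        a ^ toℕ i * a ^ suc k % e             ≡⟨ cong (_% e) (ℕ.^-distribˡ-+-* a (toℕ i) (suc k)) ⟨
        a ^ (toℕ i + suc k) % e               ≡⟨ cong (λ y → a ^ y % e) (trans (ℕ.+-suc (toℕ i) k) (ℕ.m+[n∸m]≡n i<j)) ⟩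
        a ^ toℕ j % e                         ≡⟨ toℕ-fromℕ< (m%n<n (a ^ toℕ j) e) ⟨
        toℕ (fromℕ< (m%n<n (a ^ toℕ j) e))    ≡⟨ cong toℕ fi≡fj ⟨
        toℕ (fromℕ< (m%n<n (a ^ toℕ i) e))    ≡⟨ toℕ-fromℕ< (m%n<n (a ^ toℕ i) e) ⟩
        a ^ toℕ i % e                         ∎))
      where
      open ≡-Reasoning
      k = toℕ j ∸ suc (toℕ i)
      x = pred (a ^ suc k)
      suc-x≡ : suc x ≡ a ^ suc k
      suc-x≡ = suc-pred-^ e∤a (suc k)

    -- With a^(k+1) ≡ 1, the power a^k is an inverse of a, so multiplying the given root by it
    -- removes the factor a².
    squareMod-cancel : ∀ {a b} → e ∤ a → SquareMod e (a * a * b) → SquareMod e b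
    squareMod-cancel {a} {b} e∤a (y , y²≡) with k , x , a^≡ , e∣x ← finiteOrder e∤a =
      a ^ k * y , (begin
        a ^ k * y * (a ^ k * y) % e          ≡⟨ cong (_% e) (swap (a ^ k) y) ⟩
        a ^ k * a ^ k * (y * y) % e          ≡⟨ *-mono-≋ {a ^ k * a ^ k} {_} {y * y} {a * a * b} refl y²≡ ⟩
        a ^ k * a ^ k * (a * a * b) % e      ≡⟨ cong (_% e) (regroup a (a ^ k) b) ⟩
        a ^ suc k * a ^ suc k * b % e        ≡⟨ cong (λ z → z * z * b % e) a^≡ ⟩
        suc x * suc x * b % e                ≡⟨ cong (_% e) (expand x b) ⟩
        (b + x * ((2 + x) * b)) % e          ≡⟨ %-remove-+ʳ b (ℕD.∣m⇒∣m*n _ e∣x) ⟩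
        b % e                                ∎)
      where
      open ≡-Reasoning
      swap : ∀ x y → x * y * (x * y) ≡ x * x * (y * y)
      swap = solve-∀
      regroup : ∀ a c b → c * c * (a * a * b) ≡ a * c * (a * c) * b
      regroup = solve-∀
      expand : ∀ x b → suc x * suc x * b ≡ b + x * ((2 + x) * b)
      expand = solve-∀

    -- Halve an exponent k with aᵏ ≡ 1: if k = 2g then aᵍ ≡ ±1, and if k is odd then a ≡ a^(k+1) is a square.
    square-or-selfConjugate : ∀ {a} → e ∤ a → SquareMod e a ⊎ ∃ λ j → e ∣ a ^ suc j + 1
    square-or-selfConjugate {a} e∤a with k , x , a^≡ , e∣x ← finiteOrder e∤a = <-rec Goal step k x a^≡ e∣x
      where
      Result = SquareMod e a ⊎ ∃ λ j → e ∣ a ^ suc j + 1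
      Goal : ℕ → Set
      Goal k = ∀ x → a ^ suc k ≡ suc x → e ∣ x → Result
      step : ∀ k → (∀ {k′} → k′ < k → Goal k′) → Goal k
      step k rec x a^≡ e∣x with half (suc k)
      ... | g , inj₂ refl = inj₁ (a ^ suc g , (begin
        a ^ suc g * a ^ suc g % e      ≡⟨ cong (_% e) (ℕ.^-distribˡ-+-* a (suc g) (suc g)) ⟨
        a ^ (suc g + suc g) % e        ≡⟨ cong (λ n → a ^ suc n % e) (ℕ.+-suc g g) ⟩
        a * a ^ suc (g + g) % e        ≡⟨ cong (λ y → a * y % e) a^≡ ⟩
        a * suc x % e                  ≡⟨ cong (_% e) (ℕ.*-suc a x) ⟩
        (a + a * x) % e                ≡⟨ %-remove-+ʳ a (ℕD.∣n⇒∣m*n a e∣x) ⟩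
        a % e                          ∎))
        where open ≡-Reasoning
      ... | suc g , inj₁ 1+k≡ with euclidsLemma y (y + 2) e-prime (subst (e ∣_) (ℕ.suc-injective x≡) e∣x)
        where
        y = pred (a ^ suc g)
        suc-y≡ : suc y ≡ a ^ suc g
        suc-y≡ = suc-pred-^ e∤a (suc g)
        open ≡-Reasoning
        expand : ∀ y → suc y * suc y ≡ suc (y * (y + 2))
        expand = solve-∀
        x≡ : suc x ≡ suc (y * (y + 2))
        x≡ = begin
          suc x                      ≡⟨ a^≡ ⟨
          a ^ suc k                  ≡⟨ cong (a ^_) 1+k≡ ⟩
          a ^ (suc g + suc g)        ≡⟨ ℕ.^-distribˡ-+-* a (suc g) (suc g) ⟩
          a ^ suc g * a ^ suc g      ≡⟨ cong (λ z → z * z) suc-y≡ ⟨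
          suc y * suc y              ≡⟨ expand y ⟩
          suc (y * (y + 2))          ∎
      ...   | inj₁ e∣y = rec (subst (g <_) (sym (ℕ.suc-injective 1+k≡)) (ℕ.m<m+n g (s≤s z≤n))) _
                           (sym (suc-pred-^ e∤a (suc g))) e∣y
      ...   | inj₂ e∣y+2 = inj₂ (g , subst (e ∣_) (trans (ℕ.+-suc _ 1) (cong (_+ 1) (suc-pred-^ e∤a (suc g)))) e∣y+2)

    -- Mann's test applied to all prime factors.

    1<e : 1 < e
    1<e = ℕ.nonTrivial⇒n>1 e {{prime⇒nonTrivial e-prime}}

    primeDivisor : ∀ a .{{_ : NonZero a}} → a ≢ 1 → ∃₂ λ p a′ → Prime p × a ≡ p * a′
    primeDivisor a a≢1 with factorise a
    ... | record { factors = [] ; isFactorisation = a≡1 } = ⊥-elim (a≢1 a≡1)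
    ... | record { factors = p ∷ ps ; isFactorisation = a≡ ; factorsPrime = p-prime ∷ _ } = p , product ps , p-prime , a≡

    nonZero-factor : ∀ p {a} .{{_ : NonZero a}} a′ → a ≡ p * a′ → NonZero a′
    nonZero-factor p a′ refl = ℕ.m*n≢0⇒n≢0 p

    factor-< : ∀ {p} → Prime p → ∀ {a} .{{_ : NonZero a}} a′ → a ≡ p * a′ → a′ < a
    factor-< {p} p-prime a′ a≡ = subst (a′ <_) (trans (ℕ.*-comm a′ p) (sym a≡))
      (ℕ.m<m*n a′ p {{nonZero-factor p a′ a≡}} (ℕ.nonTrivial⇒n>1 p {{prime⇒nonTrivial p-prime}}))

    -- A prime factor of a that is a square mod e is moved to b; any other one does not divide b, so
    -- Mann's descent removes it from a twice.
    twoLevel⇒square : ∀ a .{{_ : NonZero a}} b → (∀ {p} → Prime p → p ∣ a → p ∣ b → SquareMod e p) →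
                      TwoLevel e (a * b) → SquareMod e a
    twoLevel⇒square a b common B = <-rec Goal step a (ℕ.≢-nonZero⁻¹ a) b common B
      where
      Goal : ℕ → Set
      Goal a = a ≢ 0 → ∀ b → (∀ {p} → Prime p → p ∣ a → p ∣ b → SquareMod e p) → TwoLevel e (a * b) → SquareMod e a
      step : ∀ a → (∀ {a′} → a′ < a → Goal a′) → Goal a
      step a rec a≢0 b common B with a ℕ.≟ 1
      ... | yes refl = 1 , refl
      ... | no a≢1 with p , a′ , p-prime , a≡pa′ ← primeDivisor a {{ℕ.≢-nonZero a≢0}} a≢1 = split (e ∣? p)
        where
        open ≡-Reasoning
        instance
          _ = ℕ.≢-nonZero a≢0
          a′-nonZero = nonZero-factor p a′ a≡pa′
          p-nonZero = prime⇒nonZero p-prime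
        p∣a : p ∣ a
        p∣a = subst (p ∣_) (sym a≡pa′) (ℕD.m∣m*n a′)
        a′∣a : a′ ∣ a
        a′∣a = subst (a′ ∣_) (sym a≡pa′) (ℕD.n∣m*n p)

        square : SquareMod e p → SquareMod e a
        square p-sq = subst (SquareMod e) (sym a≡pa′) (squareMod-* {e} {p} {a′} p-sq
          (rec (factor-< p-prime a′ a≡pa′) (ℕ.≢-nonZero⁻¹ a′) (p * b) common′
            (subst (TwoLevel e) (trans (cong (_* b) a≡pa′) (regroup p a′ b)) B)))
          where
          regroup : ∀ p a′ b → p * a′ * b ≡ a′ * (p * b)
          regroup = solve-∀
          -- Moving p into the second factor creates at most one new common prime, p itself, which
          -- is a square in this branch.
          common′ : ∀ {r} → Prime r → r ∣ a′ → r ∣ p * b → SquareMod e r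
          common′ {r} r-prime r∣a′ r∣pb with euclidsLemma p b r-prime r∣pb
          ... | inj₂ r∣b = common r-prime (ℕD.∣-trans r∣a′ a′∣a) r∣b
          ... | inj₁ r∣p with prime⇒irreducible p-prime r∣p
          ...   | inj₁ refl = ⊥-elim (¬prime[1] r-prime)
          ...   | inj₂ refl = p-sq

        nonsquare : p ∤ b → (∃ λ j → e ∣ p ^ suc j + 1) → SquareMod e a
        nonsquare p∤b (j , e∣p^j+1) = descend (Mann.descent p-prime 1<e j e∣p^j+1 (ℕD.∣m⇒∣m*n b p∣a) B)
          where
          descend : (∃ λ N′ → a * b ≡ p * p * N′ × TwoLevel e N′) → SquareMod e a
          descend (N′ , ab≡p²N′ , B′) = [ conclude , ⊥-elim ∘ p∤b ]′
            -- Cancelling one p from p a′ b = p² N′ shows that p divides a′ b; as p does not divide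
            -- b, a second p comes out of a.
            (euclidsLemma a′ b p-prime (ℕD.divides N′ (trans a′b≡pN′ (ℕ.*-comm p N′))))
            where
            a′b≡pN′ : a′ * b ≡ p * N′
            a′b≡pN′ = ℕ.*-cancelˡ-≡ _ _ p (begin
              p * (a′ * b)    ≡⟨ ℕ.*-assoc p a′ b ⟨
              p * a′ * b      ≡⟨ cong (_* b) a≡pa′ ⟨
              a * b           ≡⟨ ab≡p²N′ ⟩
              p * p * N′      ≡⟨ ℕ.*-assoc p p N′ ⟩
              p * (p * N′)    ∎)
            conclude : p ∣ a′ → SquareMod e a
            conclude (ℕD.divides a″ a′≡a″p) = subst (SquareMod e) (sym a≡p²a″) (squareMod-* {e} {p * p} {a″} (p , refl)
              (rec (ℕ.<-trans (factor-< p-prime a″ a′≡pa″) (factor-< p-prime a′ a≡pa′))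
                (ℕ.≢-nonZero⁻¹ a″ {{nonZero-factor p a″ a′≡pa″}}) b
                (λ r-prime r∣a″ → common r-prime (ℕD.∣-trans r∣a″ (ℕD.∣-trans (ℕD.divides p a′≡pa″) a′∣a)))
                (subst (TwoLevel e) N′≡a″b B′)))
              where
              a′≡pa″ : a′ ≡ p * a″
              a′≡pa″ = trans a′≡a″p (ℕ.*-comm a″ p)
              a≡p²a″ : a ≡ p * p * a″
              a≡p²a″ = trans a≡pa′ (trans (cong (p *_) a′≡pa″) (sym (ℕ.*-assoc p p a″)))
              N′≡a″b : N′ ≡ a″ * b
              N′≡a″b = ℕ.*-cancelˡ-≡ _ _ (p * p) {{ℕ.m*n≢0 p p}} (begin
                p * p * N′          ≡⟨ ab≡p²N′ ⟨
                a * b               ≡⟨ cong (_* b) a≡p²a″ ⟩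
                p * p * a″ * b      ≡⟨ ℕ.*-assoc (p * p) a″ b ⟩
                p * p * (a″ * b)    ∎)

        split : Dec (e ∣ p) → SquareMod e a
        -- If e divides p then p ≡ 0, with root 0.
        split (yes e∣p) = square (0 , trans (m*n%n≡0 0 e) (sym (ℕD.n∣m⇒m%n≡0 p e e∣p)))
        split (no e∤p) with square-or-selfConjugate e∤p
        ... | inj₁ p-sq = square p-sq
        ... | inj₂ p-sc with p ∣? b
        ...   | yes p∣b = square (common p-prime p∣a p∣b)
        ...   | no p∤b = nonsquare p∤b p-sc

-- From a binary sequence to a two-level sequence of period e.

open import Data.Integer as ℤ using (ℤ; +_; -_; _+_; _*_)
open import Data.Integer.Divisibility as ℤD using ()
open import Data.Integer using (-[1+_]; ∣_∣)

-- b is the image of a under ℤ[x]/(xᴹᵉ − 1) → ℤ[x]/(xᵉ − 1).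
module Projection {m e N : ℕ} .{{_ : NonZero e}} (A : TwoLevel (suc m ℕ.* e) N) where
  open ≡-Reasoning
  open TwoLevel A renaming (seq to a; periodic to a-periodic)

  M = suc m

  b : ℕ → ℕ
  b i = ∑ M (λ s → a (i ℕ.+ s ℕ.* e))

  b-periodic : Periodic e b
  b-periodic i = begin
    ∑ M (λ s → a (i ℕ.+ e ℕ.+ s ℕ.* e))    ≡⟨ ∑-cong M (λ s → cong a (next i e s)) ⟩
    ∑ M (λ s → g (s ℕ.+ 1))                ≡⟨ ∑-shift g-periodic 1 ⟩
    ∑ M g                                  ∎
    where
    g : ℕ → ℕ
    g s = a (i ℕ.+ s ℕ.* e)
    next : ∀ i e s → i ℕ.+ e ℕ.+ s ℕ.* e ≡ i ℕ.+ (s ℕ.+ 1) ℕ.* e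
    next = solve-∀
    g-periodic : Periodic M g
    g-periodic s = trans (cong a (trans (cong (i ℕ.+_) (ℕ.*-distribʳ-+ e s M)) (sym (ℕ.+-assoc i _ _)))) (a-periodic _)

  c : ℕ → ℕ
  c t = ∑ (M ℕ.* e) (λ x → a x ℕ.* a (x ℕ.+ t))

  -- Periodicity of `b` allows its argument to move with the block, so the double sum over k and s
  -- becomes one sum over the long period; expanding the second `b` then gives the correlations of
  -- `a` at all shifts congruent to t.
  correlation-b : ∀ t → ∑ e (λ k → b k ℕ.* b (k ℕ.+ t)) ≡ ∑ M (λ s → c (t ℕ.+ s ℕ.* e))
  correlation-b t = begin
    ∑ e (λ k → b k ℕ.* b (k ℕ.+ t))
      ≡⟨ ∑-cong e (λ k → ∑-*ʳ M (b (k ℕ.+ t)) (λ s → a (k ℕ.+ s ℕ.* e))) ⟨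
    ∑ e (λ k → ∑ M (λ s → a (k ℕ.+ s ℕ.* e) ℕ.* b (k ℕ.+ t)))
      ≡⟨ ∑-cong e (λ k → ∑-cong M (λ s → cong (a (k ℕ.+ s ℕ.* e) ℕ.*_)
           (trans (sym (periodic-+* b-periodic (k ℕ.+ t) s)) (cong b (x+y+z≡x+z+y k t (s ℕ.* e)))))) ⟩
    ∑ e (λ k → ∑ M (λ s → f (k ℕ.+ s ℕ.* e)))
      ≡⟨ ∑-swap e M (λ k s → f (k ℕ.+ s ℕ.* e)) ⟩
    ∑ M (λ s → ∑ e (λ k → f (k ℕ.+ s ℕ.* e)))
      ≡⟨ ∑-blocks M e f ⟨
    ∑ (M ℕ.* e) f
      ≡⟨ ∑-cong (M ℕ.* e) (λ x → ∑-*ˡ M (a x) (λ s → a (x ℕ.+ t ℕ.+ s ℕ.* e))) ⟨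
    ∑ (M ℕ.* e) (λ x → ∑ M (λ s → a x ℕ.* a (x ℕ.+ t ℕ.+ s ℕ.* e)))
      ≡⟨ ∑-cong (M ℕ.* e) (λ x → ∑-cong M (λ s → cong (λ y → a x ℕ.* a y) (ℕ.+-assoc x t (s ℕ.* e)))) ⟩
    ∑ (M ℕ.* e) (λ x → ∑ M (λ s → a x ℕ.* a (x ℕ.+ (t ℕ.+ s ℕ.* e))))
      ≡⟨ ∑-swap (M ℕ.* e) M (λ x s → a x ℕ.* a (x ℕ.+ (t ℕ.+ s ℕ.* e))) ⟩
    ∑ M (λ s → c (t ℕ.+ s ℕ.* e)) ∎
    where
    f : ℕ → ℕ
    f x = a x ℕ.* b (x ℕ.+ t)
    x+y+z≡x+z+y : ∀ x y z → x ℕ.+ y ℕ.+ z ≡ x ℕ.+ z ℕ.+ y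
    x+y+z≡x+z+y = solve-∀

  c0≡ : ∀ t → (M ℕ.* e) ∤ t → c 0 ≡ c t ℕ.+ N
  c0≡ t n∤t = trans (∑-cong (M ℕ.* e) (λ k → cong (λ x → a k ℕ.* a x) (ℕ.+-identityʳ k))) (levels t n∤t)

  b-levels : ∀ t → e ∤ t → ∑ e (λ k → b k ℕ.* b k) ≡ ∑ e (λ k → b k ℕ.* b (k ℕ.+ t)) ℕ.+ N
  b-levels t e∤t = begin
    ∑ e (λ k → b k ℕ.* b k)                       ≡⟨ ∑-cong e (λ k → cong (λ x → b k ℕ.* b x) (sym (ℕ.+-identityʳ k))) ⟩
    ∑ e (λ k → b k ℕ.* b (k ℕ.+ 0))               ≡⟨ correlation-b 0 ⟩
    -- Among the shifts s e with s < M only s = 0 is a multiple of the long period, and none of the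
    -- t + s e is. Hence N appears exactly once, and the remaining terms agree in pairs.
    c 0 ℕ.+ ∑ m (λ s → c (suc s ℕ.* e))           ≡⟨ cong₂ ℕ._+_ (c0≡ _ (n∤ 0)) (∑-cong-< m others) ⟩
    c (t ℕ.+ 0) ℕ.+ N ℕ.+ ∑ m (λ s → c (t ℕ.+ suc s ℕ.* e))
                                                  ≡⟨ swap (c (t ℕ.+ 0)) N _ ⟩
    ∑ M (λ s → c (t ℕ.+ s ℕ.* e)) ℕ.+ N           ≡⟨ cong (ℕ._+ N) (correlation-b t) ⟨
    ∑ e (λ k → b k ℕ.* b (k ℕ.+ t)) ℕ.+ N         ∎
    where
    swap : ∀ x y z → x ℕ.+ y ℕ.+ z ≡ x ℕ.+ z ℕ.+ y
    swap = solve-∀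
    n∤ : ∀ s → (M ℕ.* e) ∤ (t ℕ.+ s ℕ.* e)
    n∤ s n∣ = e∤t (ℕD.∣m+n∣m⇒∣n (subst (e ℕD.∣_) (ℕ.+-comm t _) (ℕD.m*n∣⇒n∣ M e n∣)) (ℕD.n∣m*n s))
    others : ∀ s → s < m → c (suc s ℕ.* e) ≡ c (t ℕ.+ suc s ℕ.* e)
    others s s<m = ℕ.+-cancelʳ-≡ N _ _ (trans
      (sym (c0≡ _ (ℕD.>⇒∤ {{ℕ.m*n≢0 (suc s) e}} (ℕ.*-monoˡ-< e (s≤s s<m)))))
      (c0≡ _ (n∤ (suc s))))

  projected : TwoLevel e N
  projected = record { seq = b ; periodic = b-periodic ; levels = b-levels }

module FromBinary {n} (a : ℕ → ℤ) (binary : IsBinarySeq (suc n) a)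
                  (ideal : ∀ t → 1 ≤ t → t < suc n → Autocorr (suc n) a t ≡ + 1) where
  open ≡-Reasoning

  -- A is 1 + a, with values 0 and 2: adding a constant only changes multiples of 1 + x + … + xⁿ.
  A : ℕ → ℕ
  A j = ∣ a j + + 1 ∣

  +A≡a+1 : ∀ j → + A j ≡ a j + + 1
  +A≡a+1 j with proj₁ binary j
  ... | inj₁ aj≡ rewrite aj≡ = refl
  ... | inj₂ aj≡ rewrite aj≡ = refl

  A-periodic : Periodic (suc n) A
  A-periodic j = cong (λ x → ∣ x + + 1 ∣) (proj₂ binary j)

  -- The sum of (a + 1)(a′ + 1) + 1 = aa′ + (a + 1) + (a′ + 1), an arrangement with only one non-natural term.
  correlation-A : ∀ m t → + (∑ m (λ k → A k ℕ.* A (k ℕ.+ t)) ℕ.+ m) ≡ Autocorr m a t + + (∑ m A ℕ.+ ∑ m (λ k → A (k ℕ.+ t)))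
  correlation-A zero t = refl
  correlation-A (suc m) t = begin
    + (∑ (suc m) (λ k → A k ℕ.* A (k ℕ.+ t)) ℕ.+ suc m)
      ≡⟨ cong (λ x → + (x ℕ.+ suc m)) (∑-last m (λ k → A k ℕ.* A (k ℕ.+ t))) ⟩
    + (Q ℕ.+ A m ℕ.* A (m ℕ.+ t) ℕ.+ suc m)
      ≡⟨ cong +_ (regroup Q (A m ℕ.* A (m ℕ.+ t)) m) ⟩
    + (Q ℕ.+ m) + (+ (A m ℕ.* A (m ℕ.+ t)) + + 1)
      ≡⟨ cong₂ (λ x y → x + (y + + 1)) (correlation-A m t)
           (trans (ℤ.pos-* (A m) _) (cong₂ _*_ (+A≡a+1 m) (+A≡a+1 (m ℕ.+ t)))) ⟩
    Autocorr m a t + + (X ℕ.+ Y) + ((a m + + 1) * (a (m ℕ.+ t) + + 1) + + 1)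
      ≡⟨ expand (Autocorr m a t) (+ (X ℕ.+ Y)) (a m) (a (m ℕ.+ t)) ⟩
    Autocorr (suc m) a t + (+ (X ℕ.+ Y) + ((a m + + 1) + (a (m ℕ.+ t) + + 1)))
      ≡⟨ cong₂ (λ x y → Autocorr (suc m) a t + (+ (X ℕ.+ Y) + (x + y))) (+A≡a+1 m) (+A≡a+1 (m ℕ.+ t)) ⟨
    Autocorr (suc m) a t + + (X ℕ.+ Y ℕ.+ (A m ℕ.+ A (m ℕ.+ t)))
      ≡⟨ cong (λ x → Autocorr (suc m) a t + + x) (trans (regroup′ X Y (A m) _)
           (sym (cong₂ ℕ._+_ (∑-last m A) (∑-last m (λ k → A (k ℕ.+ t)))))) ⟩
    Autocorr (suc m) a t + + (∑ (suc m) A ℕ.+ ∑ (suc m) (λ k → A (k ℕ.+ t))) ∎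
    where
    Q = ∑ m (λ k → A k ℕ.* A (k ℕ.+ t))
    X = ∑ m A
    Y = ∑ m (λ k → A (k ℕ.+ t))
    regroup : ∀ x y m → x ℕ.+ y ℕ.+ suc m ≡ x ℕ.+ m ℕ.+ (y ℕ.+ 1)
    regroup = solve-∀
    regroup′ : ∀ x y z w → x ℕ.+ y ℕ.+ (z ℕ.+ w) ≡ x ℕ.+ z ℕ.+ (y ℕ.+ w)
    regroup′ = solve-∀
    expand : ∀ s w x y → s + w + ((x + + 1) * (y + + 1) + + 1) ≡ s + x * y + (w + ((x + + 1) + (y + + 1)))
    expand = ℤRing.solve-∀

  autocorr-0 : ∀ m → Autocorr m a 0 ≡ + m
  autocorr-0 zero = refl
  autocorr-0 (suc m) = trans (cong₂ _+_ (autocorr-0 m) am²≡1) (cong +_ (ℕ.+-comm m 1))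
    where
    am²≡1 : a m * a (m ℕ.+ 0) ≡ + 1
    am²≡1 rewrite ℕ.+-identityʳ m with proj₁ binary m
    ... | inj₁ am≡ rewrite am≡ = refl
    ... | inj₂ am≡ rewrite am≡ = refl

  S₀ = ∑ (suc n) A

  correlation-A′ : ∀ t {v} → Autocorr (suc n) a t ≡ + v →
                   ∑ (suc n) (λ k → A k ℕ.* A (k ℕ.+ t)) ℕ.+ suc n ≡ v ℕ.+ (S₀ ℕ.+ S₀)
  correlation-A′ t {v} eq = ℤ.+-injective (trans (correlation-A (suc n) t)
    (cong₂ (λ x y → x + + (S₀ ℕ.+ y)) eq (∑-shift A-periodic t)))

  A²-sum : ∑ (suc n) (λ k → A k ℕ.* A k) ≡ S₀ ℕ.+ S₀
  A²-sum = ℕ.+-cancelʳ-≡ (suc n) _ _ (begin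
    ∑ (suc n) (λ k → A k ℕ.* A k) ℕ.+ suc n           ≡⟨ cong (ℕ._+ suc n) (∑-cong (suc n) (λ k → cong (λ x → A k ℕ.* A x) (sym (ℕ.+-identityʳ k)))) ⟩
    ∑ (suc n) (λ k → A k ℕ.* A (k ℕ.+ 0)) ℕ.+ suc n   ≡⟨ correlation-A′ 0 (autocorr-0 (suc n)) ⟩
    suc n ℕ.+ (S₀ ℕ.+ S₀)                             ≡⟨ ℕ.+-comm (suc n) _ ⟩
    S₀ ℕ.+ S₀ ℕ.+ suc n                               ∎)

  -- The peak autocorrelation is `suc n` and every other value is 1, so the gap is `n`, one less
  -- than the period. As `ideal` concerns shifts below the period, t is first reduced to its nonzero
  -- remainder.
  A-levels : ∀ t → suc n ∤ t → ∑ (suc n) (λ k → A k ℕ.* A k) ≡ ∑ (suc n) (λ k → A k ℕ.* A (k ℕ.+ t)) ℕ.+ n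
  A-levels t n∤t = begin
    ∑ (suc n) (λ k → A k ℕ.* A k)
      ≡⟨ A²-sum ⟩
    S₀ ℕ.+ S₀
      ≡⟨ ℕ.suc-injective (trans (sym (ℕ.+-suc _ n)) (correlation-A′ r (ideal r 1≤r (m%n<n t (suc n))))) ⟨
    ∑ (suc n) (λ k → A k ℕ.* A (k ℕ.+ r)) ℕ.+ n
      ≡⟨ cong (ℕ._+ n) (∑-cong (suc n) (λ k → cong (A k ℕ.*_) (periodic-% {f = λ t → A (k ℕ.+ t)}
           (λ t → trans (cong A (sym (ℕ.+-assoc k t (suc n)))) (A-periodic _)) t))) ⟩
    ∑ (suc n) (λ k → A k ℕ.* A (k ℕ.+ t)) ℕ.+ n ∎
    where
    r = t % suc n
    1≤r : 1 ≤ r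
    1≤r = ℕ.n≢0⇒n>0 (n∤t ∘ ℕD.m%n≡0⇒n∣m t (suc n))

  twoLevel : TwoLevel (suc n) n
  twoLevel = record { seq = A ; periodic = A-periodic ; levels = A-levels }

-- Integer congruences, signs and odd parts.

≋⇒∣- : ∀ {e} .{{_ : NonZero e}} x y → x % e ≡ y % e → + e S.∣ + x ℤ.- + y
≋⇒∣- {e} x y x≋y = S.divides (+ (x / e) ℤ.- + (y / e)) (begin
  + x ℤ.- + y
    ≡⟨ cong₂ ℤ._-_ (division x) (division y) ⟩
  (+ (x % e) + + (x / e) * + e) ℤ.- (+ (y % e) + + (y / e) * + e)
    ≡⟨ cong (λ z → (+ z + + (x / e) * + e) ℤ.- (+ (y % e) + + (y / e) * + e)) x≋y ⟩
  (+ (y % e) + + (x / e) * + e) ℤ.- (+ (y % e) + + (y / e) * + e)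
    ≡⟨ cancel (+ (y % e)) (+ (x / e)) (+ (y / e)) (+ e) ⟩
  (+ (x / e) ℤ.- + (y / e)) * + e ∎)
  where
  open ≡-Reasoning
  division : ∀ x → + x ≡ + (x % e) + + (x / e) * + e
  division x = trans (cong +_ (m≡m%n+[m/n]*n x e)) (cong (λ z → + (x % e) + z) (ℤ.pos-* (x / e) e))
  cancel : ∀ r p q e → (r + p * e) ℤ.- (r + q * e) ≡ (p ℤ.- q) * e
  cancel = ℤRing.solve-∀

-- The sign of z is absorbed by −1 ≡ u².
squareMod-∣∣⇒ : ∀ {e} .{{_ : NonZero e}} {u} → + e S.∣ u * u + + 1 → ∀ {z} → SquareMod e ∣ z ∣ →
                ∃ λ x → + e S.∣ z ℤ.- x * x
squareMod-∣∣⇒ {e} {u} e∣u²+1 {+ z} (y , y²≡) = + y , subst (λ w → + e S.∣ + z ℤ.- w) (ℤ.pos-* y y) (≋⇒∣- z (y ℕ.* y) (sym y²≡))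
squareMod-∣∣⇒ {e} {u} e∣u²+1 { -[1+ z ]} (y , y²≡) = u * + y , subst (+ e S.∣_) (begin
    (+ (y ℕ.* y) ℤ.- + suc z) ℤ.- (+ (y ℕ.* y) * (u * u + + 1))
      ≡⟨ cong (λ w → (w ℤ.- + suc z) ℤ.- w * (u * u + + 1)) (ℤ.pos-* y y) ⟩
    (+ y * + y ℤ.- + suc z) ℤ.- (+ y * + y) * (u * u + + 1)
      ≡⟨ regroup (+ y) (+ suc z) u ⟩
    - + suc z ℤ.- u * + y * (u * + y) ∎)
  (S.∣m∣n⇒∣m-n (≋⇒∣- (y ℕ.* y) (suc z) y²≡) (S.∣n⇒∣m*n (+ (y ℕ.* y)) e∣u²+1))
  where
  open ≡-Reasoning
  regroup : ∀ y z u → (y * y ℤ.- z) ℤ.- (y * y) * (u * u + + 1) ≡ - z ℤ.- u * y * (u * y)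
  regroup = ℤRing.solve-∀

oddPart : ∀ c → 1 ≤ c → ∃₂ λ i c′ → c ≡ 2 ^ i ℕ.* c′ × 2 ∤ c′
oddPart = <-rec _ step
  where
  step : ∀ c → (∀ {d} → d < c → 1 ≤ d → ∃₂ λ i c′ → d ≡ 2 ^ i ℕ.* c′ × 2 ∤ c′) →
         1 ≤ c → ∃₂ λ i c′ → c ≡ 2 ^ i ℕ.* c′ × 2 ∤ c′
  step c rec 1≤c with 2 ∣? c
  ... | no 2∤c = 0 , c , sym (ℕ.+-identityʳ c) , 2∤c
  ... | yes (ℕD.divides (suc d) refl) with i , c′ , d≡ , 2∤c′ ← rec {suc d} (ℕ.m<m*n (suc d) 2 (s≤s (s≤s z≤n))) (s≤s z≤n) =
    suc i , c′ , trans (cong (ℕ._* 2) d≡) (rotate (2 ^ i) c′) , 2∤c′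
    where
    rotate : ∀ x c → x ℕ.* c ℕ.* 2 ≡ 2 ℕ.* x ℕ.* c
    rotate = solve-∀
  step .0 rec () | yes (ℕD.divides zero refl)

+∣i∣∣i∣≡i*i : ∀ i → + (∣ i ∣ ℕ.* ∣ i ∣) ≡ i * i
+∣i∣∣i∣≡i*i (+ n) = ℤ.pos-* n n
+∣i∣∣i∣≡i*i -[1+ n ] = refl

-- The factorisation of u² - 1 and the contradiction.

prime≡1[4]⇒∤2 : ∀ {e} → Prime e → e % 4 ≡ 1 → e ∤ 2
prime≡1[4]⇒∤2 e-prime e≡1 e∣2 with prime⇒irreducible prime[2] e∣2
... | inj₁ refl = ¬prime[1] e-prime
prime≡1[4]⇒∤2 e-prime () e∣2 | inj₂ refl

-- The period is written `suc n`, so `n` is the number that Mann's test factors; ε is the sign in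
-- the congruence for u, and 2n = (u - ε)(u + ε).
module IdealSequence {e} (e-prime : Prime e) (e≡1 : e % 4 ≡ 1) {u : ℤ} (n : ℕ) (2n≡u²+1 : + (2 ℕ.* suc n) ≡ u * u + + 1)
  (a : ℕ → ℤ) (binary : IsBinarySeq (suc n) a) (ideal : ∀ t → 1 ≤ t → t < suc n → Autocorr (suc n) a t ≡ + 1)
  (e∣u²+1 : e ℕD.∣ 2 ℕ.* suc n)
  {ε : ℤ} (ε²≡1 : ε * ε ≡ + 1) where
  private instance
    e≢0 : NonZero e
    e≢0 = prime⇒nonZero e-prime
  open ≡-Reasoning

  e∤2 : e ∤ 2
  e∤2 = prime≡1[4]⇒∤2 e-prime e≡1

  twoLevel : TwoLevel e n
  twoLevel with euclidsLemma 2 (suc n) e-prime e∣u²+1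
  ... | inj₁ e∣2 = ⊥-elim (e∤2 e∣2)
  ... | inj₂ (ℕD.divides (suc m) n≡me) = Projection.projected {m} {e} {n} (subst (λ k → TwoLevel k n) n≡me (FromBinary.twoLevel a binary ideal))

  U V : ℕ
  U = ∣ u ℤ.- ε ∣
  V = ∣ u + ε ∣

  UV≡2n : U ℕ.* V ≡ 2 ℕ.* n
  UV≡2n = trans (sym (ℤ.abs-* (u ℤ.- ε) (u + ε))) (cong ∣_∣ (begin
    (u ℤ.- ε) * (u + ε)              ≡⟨ expand u ε ⟩
    (u * u + + 1) ℤ.- (ε * ε + + 1)  ≡⟨ cong₂ (λ x y → x ℤ.- (y + + 1)) (sym 2n≡u²+1) ε²≡1 ⟩
    + (2 ℕ.* suc n) ℤ.- + 2          ≡⟨ cong (λ x → + x ℤ.- + 2) (ℕ.*-suc 2 n) ⟩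
    + 2 + + (2 ℕ.* n) ℤ.- + 2        ≡⟨ cancel (+ 2) (+ (2 ℕ.* n)) ⟩
    + (2 ℕ.* n)                      ∎))
    where
    expand : ∀ u ε → (u ℤ.- ε) * (u + ε) ≡ (u * u + + 1) ℤ.- (ε * ε + + 1)
    expand = ℤRing.solve-∀
    cancel : ∀ x y → x + y ℤ.- x ≡ y
    cancel = ℤRing.solve-∀

  -- A common divisor of U and 2(n + 1) divides 2n as well, hence divides 2.
  e∤U : e ∤ U
  e∤U e∣U = e∤2 (ℕD.∣m+n∣m⇒∣n (subst (e ℕD.∣_) (trans (ℕ.*-suc 2 n) (ℕ.+-comm 2 (2 ℕ.* n))) e∣u²+1)
    (subst (e ℕD.∣_) UV≡2n (ℕD.∣m⇒∣m*n V e∣U)))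

  -- The two factors differ by 2ε, and multiplication by ε removes the sign.
  common⇒∣2 : ∀ {p} → p ℕD.∣ U → p ℕD.∣ V → p ℕD.∣ 2
  common⇒∣2 {p} p∣U p∣V = S.∣⇒∣ᵤ (subst (+ p S.∣_) (begin
      ((u + ε) ℤ.- (u ℤ.- ε)) * ε    ≡⟨ expand u ε ⟩
      ε * ε * + 2                    ≡⟨ cong (_* + 2) ε²≡1 ⟩
      + 2                            ∎)
    (S.∣m⇒∣m*n ε (S.∣m∣n⇒∣m-n (S.∣ᵤ⇒∣ {+ p} {u + ε} p∣V) (S.∣ᵤ⇒∣ {+ p} {u ℤ.- ε} p∣U))))
    where
    expand : ∀ u ε → ((u + ε) ℤ.- (u ℤ.- ε)) * ε ≡ ε * ε * + 2
    expand = ℤRing.solve-∀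

  -- Mann's test for n = (c²ρ)(2ᵏV), one factor 2 of U having cancelled against 2n. The first factor
  -- is odd and shares no prime with V, so no common primes arise; afterwards c² is cancelled.
  odd-cofactor-square : ∀ k c ρ → U ≡ 2 ^ suc k ℕ.* (c ℕ.* c ℕ.* ρ) → 2 ∤ c → 2 ∤ ρ → SquareMod e ρ
  odd-cofactor-square k c ρ U≡ 2∤c 2∤ρ = squareMod-cancel e-prime e∤c
    (twoLevel⇒square e-prime (c ℕ.* c ℕ.* ρ) {{odd⇒nonZero 2∤c²ρ}} (2 ^ k ℕ.* V)
      (λ p-prime p∣c²ρ p∣2ᵏV → ⊥-elim (coprime p-prime p∣c²ρ p∣2ᵏV)) (subst (TwoLevel e) n≡ twoLevel))
    where
    odd⇒nonZero : ∀ {m} → 2 ∤ m → NonZero m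
    odd⇒nonZero {zero} 2∤0 = ⊥-elim (2∤0 (2 ℕD.∣0))
    odd⇒nonZero {suc m} _ = _
    odd-* : ∀ {x y} → 2 ∤ x → 2 ∤ y → 2 ∤ (x ℕ.* y)
    odd-* {x} {y} 2∤x 2∤y = [ 2∤x , 2∤y ]′ ∘ euclidsLemma x y prime[2]
    2∤c²ρ : 2 ∤ (c ℕ.* c ℕ.* ρ)
    2∤c²ρ = odd-* (odd-* 2∤c 2∤c) 2∤ρ
    c²ρ∣U : c ℕ.* c ℕ.* ρ ℕD.∣ U
    c²ρ∣U = subst (c ℕ.* c ℕ.* ρ ℕD.∣_) (sym U≡) (ℕD.n∣m*n (2 ^ suc k))
    e∤c : e ∤ c
    e∤c e∣c = e∤U (ℕD.∣-trans (ℕD.∣m⇒∣m*n ρ (ℕD.∣m⇒∣m*n c e∣c)) c²ρ∣U)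
    ∣2⇒∤ : ∀ {p} → Prime p → p ℕD.∣ 2 → p ∤ (c ℕ.* c ℕ.* ρ)
    ∣2⇒∤ p-prime p∣2 p∣c²ρ with prime⇒irreducible prime[2] p∣2
    ... | inj₁ refl = ¬prime[1] p-prime
    ... | inj₂ refl = 2∤c²ρ p∣c²ρ
    ∣2^⇒∣2 : ∀ {p} → Prime p → ∀ k → p ℕD.∣ 2 ^ k → p ℕD.∣ 2
    ∣2^⇒∣2 p-prime zero p∣1 = ℕD.∣-trans p∣1 (ℕD.1∣ 2)
    ∣2^⇒∣2 p-prime (suc k) p∣ with euclidsLemma 2 (2 ^ k) p-prime p∣
    ... | inj₁ p∣2 = p∣2
    ... | inj₂ p∣2ᵏ = ∣2^⇒∣2 p-prime k p∣2ᵏ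
    coprime : ∀ {p} → Prime p → p ℕD.∣ c ℕ.* c ℕ.* ρ → p ℕD.∣ 2 ^ k ℕ.* V → ⊥
    coprime p-prime p∣c²ρ p∣2ᵏV with euclidsLemma (2 ^ k) V p-prime p∣2ᵏV
    ... | inj₁ p∣2ᵏ = ∣2⇒∤ p-prime (∣2^⇒∣2 p-prime k p∣2ᵏ) p∣c²ρ
    ... | inj₂ p∣V = ∣2⇒∤ p-prime (common⇒∣2 (ℕD.∣-trans p∣c²ρ c²ρ∣U) p∣V) p∣c²ρ
    n≡ : n ≡ c ℕ.* c ℕ.* ρ ℕ.* (2 ^ k ℕ.* V)
    n≡ = ℕ.*-cancelˡ-≡ _ _ 2 (begin
      2 ℕ.* n                                            ≡⟨ UV≡2n ⟨
      U ℕ.* V                                            ≡⟨ cong (ℕ._* V) U≡ ⟩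
      2 ℕ.* 2 ^ k ℕ.* (c ℕ.* c ℕ.* ρ) ℕ.* V              ≡⟨ regroup (2 ^ k) (c ℕ.* c ℕ.* ρ) V ⟩
      2 ℕ.* (c ℕ.* c ℕ.* ρ ℕ.* (2 ^ k ℕ.* V))            ∎)
      where
      regroup : ∀ t x v → 2 ℕ.* t ℕ.* x ℕ.* v ≡ 2 ℕ.* (x ℕ.* (t ℕ.* v))
      regroup = solve-∀

  contradiction : ∀ c l {r} → 1 ≤ c → 2 ℕD.∣ 2 ^ l ℕ.* c → ¬ (+ 2 ℤD.∣ r) → QNR e r →
                  CongMod (+ (2 ^ suc l ℕ.* c ℕ.* c ℕ.* e)) u (+ (2 ^ l ℕ.* c ℕ.* c) * r + ε) → ⊥
  contradiction c l {r} 1≤c 2∣2ˡc 2∤r (_ , r-nonsquare) cong-u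
    with S.divides q u-≡ ← S.∣ᵤ⇒∣ {+ (2 ^ suc l ℕ.* c ℕ.* c ℕ.* e)} {u ℤ.- (+ (2 ^ l ℕ.* c ℕ.* c) * r + ε)} cong-u
    with i , c′ , refl , 2∤c′ ← oddPart c 1≤c
    = r-nonsquare (proj₁ square , S.∣⇒∣ᵤ (subst (+ e S.∣_) (cancel r (q * (+ 2 * + e)) (proj₁ square))
        (S.∣m∣n⇒∣m-n (proj₂ square) (S.∣n⇒∣m*n q (S.∣n⇒∣m*n (+ 2) S.∣-refl)))))
    where
    K = 2 ^ l ℕ.* c ℕ.* c
    -- The congruence for u becomes the equality u - ε = K r′. Changing r by a multiple of 2e
    -- preserves both its parity and its class mod e.
    r′ = r + q * (+ 2 * + e)
    cancel : ∀ r x y → (r + x ℤ.- y * y) ℤ.- x ≡ r ℤ.- y * y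
    cancel = ℤRing.solve-∀
    modulus : 2 ^ suc l ℕ.* c ℕ.* c ℕ.* e ≡ K ℕ.* (2 ℕ.* e)
    modulus = regroup (2 ^ l) c e
      where
      regroup : ∀ t c e → 2 ℕ.* t ℕ.* c ℕ.* c ℕ.* e ≡ t ℕ.* c ℕ.* c ℕ.* (2 ℕ.* e)
      regroup = solve-∀
    u-ε≡Kr′ : u ℤ.- ε ≡ + K * r′
    u-ε≡Kr′ = begin
      u ℤ.- ε                                     ≡⟨ split u (+ K * r) ε ⟩
      + K * r + (u ℤ.- (+ K * r + ε))             ≡⟨ cong (λ z → + K * r + z) u-≡ ⟩
      + K * r + q * + (2 ^ suc l ℕ.* c ℕ.* c ℕ.* e)
        ≡⟨ cong (λ x → + K * r + q * x) (trans (cong +_ modulus) (trans (ℤ.pos-* K (2 ℕ.* e)) (cong (λ z → + K * z) (ℤ.pos-* 2 e)))) ⟩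
      + K * r + q * (+ K * (+ 2 * + e))           ≡⟨ factor (+ K) r q (+ 2 * + e) ⟩
      + K * r′                                    ∎
      where
      split : ∀ u x ε → u ℤ.- ε ≡ x + (u ℤ.- (x + ε))
      split = ℤRing.solve-∀
      factor : ∀ k r q f → k * r + q * (k * f) ≡ k * (r + q * f)
      factor = ℤRing.solve-∀
    U≡ : U ≡ 2 ^ (l ℕ.+ (i ℕ.+ i)) ℕ.* (c′ ℕ.* c′ ℕ.* ∣ r′ ∣)
    U≡ = begin
      U                                                       ≡⟨ cong ∣_∣ u-ε≡Kr′ ⟩
      ∣ + K * r′ ∣                                            ≡⟨ ℤ.abs-* (+ K) r′ ⟩
      K ℕ.* ∣ r′ ∣                                            ≡⟨ regroup (2 ^ l) (2 ^ i) c′ ∣ r′ ∣ ⟩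
      2 ^ l ℕ.* (2 ^ i ℕ.* 2 ^ i) ℕ.* (c′ ℕ.* c′ ℕ.* ∣ r′ ∣)  ≡⟨ cong (ℕ._* (c′ ℕ.* c′ ℕ.* ∣ r′ ∣))
                                                                   (trans (cong (2 ^ l ℕ.*_) (sym (ℕ.^-distribˡ-+-* 2 i i))) (sym (ℕ.^-distribˡ-+-* 2 l (i ℕ.+ i)))) ⟩
      2 ^ (l ℕ.+ (i ℕ.+ i)) ℕ.* (c′ ℕ.* c′ ℕ.* ∣ r′ ∣)        ∎
      where
      regroup : ∀ t s c ρ → t ℕ.* (s ℕ.* c) ℕ.* (s ℕ.* c) ℕ.* ρ ≡ t ℕ.* (s ℕ.* s) ℕ.* (c ℕ.* c ℕ.* ρ)
      regroup = solve-∀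
    -- The evenness of 2ˡc ensures that U has a factor 2 to cancel: either l > 0 or c contributes
    -- one.
    positive-exponent : ∀ l i → 2 ℕD.∣ 2 ^ l ℕ.* (2 ^ i ℕ.* c′) → ∃ λ k → l ℕ.+ (i ℕ.+ i) ≡ suc k
    positive-exponent (suc l) i _ = _ , refl
    positive-exponent zero (suc i) _ = _ , refl
    positive-exponent zero zero 2∣c′ = ⊥-elim (2∤c′ (subst (2 ℕD.∣_) (trans (ℕ.+-identityʳ _) (ℕ.+-identityʳ c′)) 2∣c′))
    2∤r′ : 2 ∤ ∣ r′ ∣
    2∤r′ 2∣r′ = 2∤r (S.∣⇒∣ᵤ (S.∣m+n∣n⇒∣m {+ 2} {r} (S.∣ᵤ⇒∣ {+ 2} {r′} 2∣r′) (S.∣n⇒∣m*n q (S.∣m⇒∣m*n (+ e) (S.∣-refl {+ 2})))))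
    square : ∃ λ x → + e S.∣ r′ ℤ.- x * x
    square with k , eq ← positive-exponent l i 2∣2ˡc =
      squareMod-∣∣⇒ {u = u} (subst (+ e S.∣_) 2n≡u²+1 (S.∣ᵤ⇒∣ {+ e} {+ (2 ℕ.* suc n)} e∣u²+1)) {r′}
        (odd-cofactor-square k c′ ∣ r′ ∣ (subst (λ x → U ≡ 2 ^ x ℕ.* (c′ ℕ.* c′ ℕ.* ∣ r′ ∣)) eq U≡) 2∤c′ 2∤r′)

theorem2p10 : (e : ℕ) → Prime e → e % 4 ≡ 1 →
    (u : ℤ) → ¬ (+ 2 ℤD.∣ u) → CongMod (+ e) (u * u) (- + 1) →
    (c l : ℕ) (r : ℤ) → 1 ≤ c → 2 ℕD.∣ (2 ^ l ℕ.* c) → ¬ (+ 2 ℤD.∣ r) → QNR e r →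
    (CongMod (+ (2 ^ ℕ.suc l ℕ.* c ℕ.* c ℕ.* e)) u (+ (2 ^ l ℕ.* c ℕ.* c) * r + + 1)
    ⊎ CongMod (+ (2 ^ ℕ.suc l ℕ.* c ℕ.* c ℕ.* e)) u (+ (2 ^ l ℕ.* c ℕ.* c) * r ℤ.- + 1)) →
    (n : ℕ) → + (2 ℕ.* n) ≡ u * u + + 1 →
    ¬ (∃ λ (a : ℕ → ℤ) → IsBinarySeq n a × (∀ t → 1 ≤ t → t ℕ.< n → Autocorr n a t ≡ + 1))
theorem2p10 e e-prime e≡1 u _ u²≡-1 c l r 1≤c 2∣2ˡc 2∤r r-nonresidue u≡ zero 2n≡u²+1 _
  -- Period 0 would give 0 = u² + 1, which is impossible for the natural number |u|² + 1.
  with () ← trans (ℤ.+-injective (trans 2n≡u²+1 (cong (_+ + 1) (sym (+∣i∣∣i∣≡i*i u))))) (ℕ.+-comm (∣ u ∣ ℕ.* ∣ u ∣) 1)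
theorem2p10 e e-prime e≡1 u _ u²≡-1 c l r 1≤c 2∣2ˡc 2∤r r-nonresidue u≡ (suc n) 2n≡u²+1 (a , binary , ideal) =
  [ IdealSequence.contradiction e-prime e≡1 {u} n 2n≡u²+1 a binary ideal e∣2n {+ 1} refl c l {r} 1≤c 2∣2ˡc 2∤r r-nonresidue
  , IdealSequence.contradiction e-prime e≡1 {u} n 2n≡u²+1 a binary ideal e∣2n { - + 1} refl c l {r} 1≤c 2∣2ˡc 2∤r r-nonresidue ]′ u≡
  where
  e∣2n : e ℕD.∣ 2 ℕ.* suc n
  -- Subtracting -1 computes to adding 1, so `u²≡-1` already is divisibility of the absolute value
  -- of u² + 1.
  e∣2n = subst (λ x → e ℕD.∣ ∣ x ∣) (sym 2n≡u²+1) u²≡-1
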